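{- Let $p$ be a prime and let $S$ be a $p$-divisible multiset on $\mathbb{F}_p^3$ over $\mathbb{F}_p$, with weight function $f_S:\mathbb{F}_p^3\to\mathbb{F}_p$; that is, $\sum_{x\in H} f_S(x)=0$ in $\mathbb{F}_p$ for every affine plane $H\subseteq\mathbb{F}_p^3$. Then $f_S$ lies in each of the following $\mathbb{F}_p$-linear subspaces of the space of functions $\mathbb{F}_p^3\to\mathbb{F}_p$: 1. the $\mathbb{F}_p$-linear span of (the characteristic functions of) cylinders; 2. the $\mathbb{F}_p$-linear span of (the weight functions of) cylinder type multisets; 3. the $\mathbb{F}_p$-linear span of differences of parallel lines, i.e. $\operatorname{Span}_{\mathbb{F}_p}\{\mathbf{1}_{\ell_1}-\mathbf{1}_{\ell_2} : \ell_1,\ell_2 \text{ affine lines in } \mathbb{F}_p^3,\ \ell_1\parallel \ell_2\}$.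
   Context: Lines and planes are affine one- and two-dimensional subspaces of $\mathbb{F}_p^3$. For a subset $X\subseteq\mathbb{F}_p^3$, $\mathbf{1}_X$ denotes its characteristic function, here regarded as $\mathbb{F}_p$-valued. Write $\ell_1\parallel\ell_2$ if the lines $\ell_1,\ell_2$ are parallel. A cylinder is a subset of $\mathbb{F}_p^3$ that is the union of $p$ pairwise disjoint parallel lines (so it has $p^2$ points). A cylinder type multiset is one whose weight function is a sum $\mathbf{1}_{\ell_1}+\dots+\mathbf{1}_{\ell_p}$ of characteristic functions of $p$ pairwise parallel, not necessarily distinct, affine lines (here taken with values in $\mathbb{F}_p$). A multiset over $\mathbb{F}_p$ is identified with its weight function $\mathbb{F}_p^3\to\mathbb{F}_p$. -}

module Defs where

open import Algebra.Bundles using (CommutativeRing)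
open import Algebra.Structures using (IsCommutativeRing)
import Algebra.Properties.CommutativeMonoid.Sum as Sum
open import Data.Bool.Base using (if_then_else_)
open import Data.Fin.Base using (Fin; toℕ)
import Data.Fin.Properties as Fin
open import Data.List.Base as List using (List; allFin; cartesianProductWith; filter)
open import Data.List.Membership.Propositional as List∈ using ()
open import Data.List.Membership.Propositional.Properties using (∈-allFin; ∈-cartesianProductWith⁺)
open import Data.List.Relation.Unary.Any using (here)
open import Data.List.Relation.Unary.All using ([])
open import Data.List.Relation.Unary.AllPairs using ([]; _∷_)
open import Data.List.Relation.Unary.Unique.Propositional using (Unique)
open import Data.List.Relation.Unary.Unique.Propositional.Properties using (allFin⁺; cartesianProductWith⁺)
open import Data.Nat.Base as ℕ using (ℕ; zero; suc; NonZero)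
open import Data.Nat.DivMod using (_%_; _mod_; m%n<n; %-distribˡ-+; %-distribˡ-*; n%n≡0; m<n⇒m%n≡m)
import Data.Nat.Properties as ℕ
open import Data.Product.Base using (Σ-syntax; ∃; ∃₂; _×_; _,_)
open import Data.Vec.Base as Vec using (Vec; []; _∷_; zipWith; replicate)
open import Data.Vec.Functional using (Vector)
open import Data.Vec.Properties using (∷-injective; ≡-dec)
open import Level using (0ℓ)
open import Relation.Binary.Definitions using (DecidableEquality)
open import Relation.Binary.PropositionalEquality
open import Relation.Nullary.Decidable using (does)
open import Relation.Unary using (Pred; Decidable; _∈_; _⊥_; ⋃)

-- The ring ℤ/p, carried by the canonical residues Fin p. It is the field
-- 𝔽_p as soon as p is prime; the ring structure only needs p ≢ 0.

module _ (p : ℕ) .{{_ : NonZero p}} where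

  private
    π : ℕ → Fin p
    π m = m mod p

    infixl 6 _⊞_
    infixl 7 _⊠_

    _⊞_ _⊠_ : Fin p → Fin p → Fin p
    a ⊞ b = π (toℕ a ℕ.+ toℕ b)
    a ⊠ b = π (toℕ a ℕ.* toℕ b)

    ⊟_ : Fin p → Fin p
    ⊟ a = π (p ℕ.∸ toℕ a)

    toℕ-π : ∀ m → toℕ (π m) ≡ m % p
    toℕ-π m = Fin.toℕ-fromℕ< (m%n<n m p)

    π-toℕ : ∀ a → π (toℕ a) ≡ a
    π-toℕ a = Fin.toℕ-injective (trans (toℕ-π (toℕ a)) (m<n⇒m%n≡m (Fin.toℕ<n a)))

    π-cong : ∀ {m n} → m % p ≡ n % p → π m ≡ π n
    π-cong {m} {n} eq = Fin.toℕ-injective (trans (toℕ-π m) (trans eq (sym (toℕ-π n))))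

    π-+ : ∀ m n → π m ⊞ π n ≡ π (m ℕ.+ n)
    π-+ m n = π-cong (trans (cong₂ (λ a b → (a ℕ.+ b) % p) (toℕ-π m) (toℕ-π n))
                            (sym (%-distribˡ-+ m n p)))

    π-* : ∀ m n → π m ⊠ π n ≡ π (m ℕ.* n)
    π-* m n = π-cong (trans (cong₂ (λ a b → (a ℕ.* b) % p) (toℕ-π m) (toℕ-π n))
                            (sym (%-distribˡ-* m n p)))

    ⊞-comm : ∀ a b → a ⊞ b ≡ b ⊞ a
    ⊞-comm a b = cong π (ℕ.+-comm (toℕ a) (toℕ b))

    ⊠-comm : ∀ a b → a ⊠ b ≡ b ⊠ a
    ⊠-comm a b = cong π (ℕ.*-comm (toℕ a) (toℕ b))

    ⊞-π : ∀ a n → a ⊞ π n ≡ π (toℕ a ℕ.+ n)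
    ⊞-π a n = trans (cong (_⊞ π n) (sym (π-toℕ a))) (π-+ (toℕ a) n)

    ⊠-π : ∀ a n → a ⊠ π n ≡ π (toℕ a ℕ.* n)
    ⊠-π a n = trans (cong (_⊠ π n) (sym (π-toℕ a))) (π-* (toℕ a) n)

    ⊞-assoc : ∀ a b c → (a ⊞ b) ⊞ c ≡ a ⊞ (b ⊞ c)
    ⊞-assoc a b c = begin
      (a ⊞ b) ⊞ c                       ≡⟨ ⊞-comm (a ⊞ b) c ⟩
      c ⊞ (a ⊞ b)                       ≡⟨ ⊞-π c _ ⟩
      π (toℕ c ℕ.+ (toℕ a ℕ.+ toℕ b))   ≡⟨ cong π (ℕ.+-comm (toℕ c) _) ⟩
      π ((toℕ a ℕ.+ toℕ b) ℕ.+ toℕ c)   ≡⟨ cong π (ℕ.+-assoc (toℕ a) (toℕ b) (toℕ c)) ⟩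
      π (toℕ a ℕ.+ (toℕ b ℕ.+ toℕ c))   ≡⟨ ⊞-π a _ ⟨
      a ⊞ (b ⊞ c)                       ∎
      where open ≡-Reasoning

    ⊠-assoc : ∀ a b c → (a ⊠ b) ⊠ c ≡ a ⊠ (b ⊠ c)
    ⊠-assoc a b c = begin
      (a ⊠ b) ⊠ c                       ≡⟨ ⊠-comm (a ⊠ b) c ⟩
      c ⊠ (a ⊠ b)                       ≡⟨ ⊠-π c _ ⟩
      π (toℕ c ℕ.* (toℕ a ℕ.* toℕ b))   ≡⟨ cong π (ℕ.*-comm (toℕ c) _) ⟩
      π ((toℕ a ℕ.* toℕ b) ℕ.* toℕ c)   ≡⟨ cong π (ℕ.*-assoc (toℕ a) (toℕ b) (toℕ c)) ⟩
      π (toℕ a ℕ.* (toℕ b ℕ.* toℕ c))   ≡⟨ ⊠-π a _ ⟨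
      a ⊠ (b ⊠ c)                       ∎
      where open ≡-Reasoning

    ⊞-identityʳ : ∀ a → a ⊞ π 0 ≡ a
    ⊞-identityʳ a = trans (⊞-π a 0) (trans (cong π (ℕ.+-identityʳ _)) (π-toℕ a))

    ⊠-identityʳ : ∀ a → a ⊠ π 1 ≡ a
    ⊠-identityʳ a = trans (⊠-π a 1) (trans (cong π (ℕ.*-identityʳ _)) (π-toℕ a))

    ⊟-inverseʳ : ∀ a → a ⊞ (⊟ a) ≡ π 0
    ⊟-inverseʳ a = begin
      a ⊞ (⊟ a)                         ≡⟨ ⊞-π a _ ⟩
      π (toℕ a ℕ.+ (p ℕ.∸ toℕ a))       ≡⟨ cong π (ℕ.m+[n∸m]≡n (ℕ.<⇒≤ (Fin.toℕ<n a))) ⟩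
      π p                               ≡⟨ π-cong (trans (n%n≡0 p) (sym (m<n⇒m%n≡m (ℕ.>-nonZero⁻¹ p)))) ⟩
      π 0                               ∎
      where open ≡-Reasoning

    ⊠-distribˡ-⊞ : ∀ a b c → a ⊠ (b ⊞ c) ≡ (a ⊠ b) ⊞ (a ⊠ c)
    ⊠-distribˡ-⊞ a b c = begin
      a ⊠ (b ⊞ c)                                   ≡⟨ ⊠-π a _ ⟩
      π (toℕ a ℕ.* (toℕ b ℕ.+ toℕ c))               ≡⟨ cong π (ℕ.*-distribˡ-+ (toℕ a) _ _) ⟩
      π (toℕ a ℕ.* toℕ b ℕ.+ toℕ a ℕ.* toℕ c)       ≡⟨ π-+ _ _ ⟨
      (a ⊠ b) ⊞ (a ⊠ c)                             ∎
      where open ≡-Reasoning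

    comm⇒ˡ : ∀ {_∙_ : Fin p → Fin p → Fin p} {e} → (∀ a b → a ∙ b ≡ b ∙ a) →
             (∀ a → a ∙ e ≡ a) → ∀ a → e ∙ a ≡ a
    comm⇒ˡ comm idʳ a = trans (comm _ a) (idʳ a)

    isCommutativeRing : IsCommutativeRing _≡_ _⊞_ _⊠_ ⊟_ (π 0) (π 1)
    isCommutativeRing = record
      { isRing = record
        { +-isAbelianGroup = record
          { isGroup = record
            { isMonoid = record
              { isSemigroup = record
                { isMagma = record { isEquivalence = isEquivalence ; ∙-cong = cong₂ _⊞_ }
                ; assoc   = ⊞-assoc
                }
              ; identity = comm⇒ˡ ⊞-comm ⊞-identityʳ , ⊞-identityʳ
              }
            ; inverse = (λ a → trans (⊞-comm (⊟ a) a) (⊟-inverseʳ a)) , ⊟-inverseʳ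
            ; ⁻¹-cong = cong ⊟_
            }
          ; comm = ⊞-comm
          }
        ; *-cong     = cong₂ _⊠_
        ; *-assoc    = ⊠-assoc
        ; *-identity = comm⇒ˡ ⊠-comm ⊠-identityʳ , ⊠-identityʳ
        ; distrib    = ⊠-distribˡ-⊞
                     , (λ a b c → trans (⊠-comm (b ⊞ c) a)
                         (trans (⊠-distribˡ-⊞ a b c) (cong₂ _⊞_ (⊠-comm a b) (⊠-comm a c))))
        }
      ; *-comm = ⊠-comm
      }

  𝔽-commutativeRing : CommutativeRing 0ℓ 0ℓ
  𝔽-commutativeRing = record { isCommutativeRing = isCommutativeRing }

module _ (p : ℕ) .{{_ : NonZero p}} where

  open CommutativeRing (𝔽-commutativeRing p) using (_+_; _*_; _-_; 0#; 1#; +-commutativeMonoid)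
  open Sum +-commutativeMonoid using (sum-syntax)

  𝔽 : Set
  𝔽 = Fin p

  Point : Set
  Point = Vec 𝔽 3

  infixl 6 _⊕_
  infixr 7 _•_

  _⊕_ : Point → Point → Point
  _⊕_ = zipWith _+_

  _•_ : 𝔽 → Point → Point
  c • x = Vec.map (c *_) x

  𝟘 : Point
  𝟘 = replicate 3 0#

  _≟_ : DecidableEquality Point
  _≟_ = ≡-dec Fin._≟_

  -- All vectors of 𝔽ⁿ, each listed exactly once (see the two lemmas below).
  vectors : ∀ n → List (Vec 𝔽 n)
  vectors zero    = [] List.∷ List.[]
  vectors (suc n) = cartesianProductWith _∷_ (allFin p) (vectors n)

  vectors-complete : ∀ {n} (x : Vec 𝔽 n) → x List∈.∈ vectors n
  vectors-complete []      = here refl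
  vectors-complete (a ∷ x) = ∈-cartesianProductWith⁺ _∷_ (∈-allFin a) (vectors-complete x)

  vectors-unique : ∀ n → Unique (vectors n)
  vectors-unique zero    = [] ∷ []
  vectors-unique (suc n) = cartesianProductWith⁺ _∷_ ∷-injective (allFin⁺ p) (vectors-unique n)

  -- A line (plane) is given by a point and a basis of its direction space.
  -- Different records may present the same line (plane); everything below
  -- depends on the underlying point set only.
  record Line : Set where
    field
      base        : Point
      direction   : Point
      direction≢0 : direction ≢ 𝟘

  record Plane : Set where
    field
      base        : Point
      u v         : Point
      independent : ∀ s t → s • u ⊕ t • v ≡ 𝟘 → s ≡ 0# × t ≡ 0#

  ⟦_⟧ : Line → Pred Point 0ℓ
  ⟦ ℓ ⟧ x = ∃ λ t → x ≡ base ⊕ t • direction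
    where open Line ℓ

  ⟦_⟧? : ∀ ℓ → Decidable ⟦ ℓ ⟧
  ⟦ ℓ ⟧? x = Fin.any? λ t → x ≟ (base ⊕ t • direction)
    where open Line ℓ

  ⟪_⟫ : Plane → Pred Point 0ℓ
  ⟪ H ⟫ x = ∃₂ λ s t → x ≡ base ⊕ (s • u ⊕ t • v)
    where open Plane H

  ⟪_⟫? : ∀ H → Decidable ⟪ H ⟫
  ⟪ H ⟫? x = Fin.any? λ s → Fin.any? λ t → x ≟ (base ⊕ (s • u ⊕ t • v))
    where open Plane H

  -- Equality of the direction spaces: both directions are nonzero, so the
  -- factor c is automatically nonzero. Every line is parallel to itself.
  _∥_ : Line → Line → Set
  ℓ₁ ∥ ℓ₂ = ∃ λ c → Line.direction ℓ₁ ≡ c • Line.direction ℓ₂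

  PairwiseParallel : ∀ {n} → Vector Line n → Set
  PairwiseParallel ℓ = ∀ i j → ℓ i ∥ ℓ j

  PairwiseDisjoint : ∀ {n} → Vector Line n → Set
  PairwiseDisjoint ℓ = ∀ i j → i ≢ j → ⟦ ℓ i ⟧ ⊥ ⟦ ℓ j ⟧

  record Cylinder : Set where
    field
      lines    : Vector Line p
      parallel : PairwiseParallel lines
      disjoint : PairwiseDisjoint lines

    points : Pred Point 0ℓ
    points = ⋃ (Fin p) λ i → ⟦ lines i ⟧

    points? : Decidable points
    points? x = Fin.any? λ i → ⟦ lines i ⟧? x

  -- Equality of functions is pointwise (_≗_) throughout.
  Function : Set
  Function = Point → 𝔽

  𝟏 : {X : Pred Point 0ℓ} → Decidable X → Function
  𝟏 X? x = if does (X? x) then 1# else 0#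

  sumOver : {X : Pred Point 0ℓ} → Decidable X → Function → 𝔽
  sumOver X? f = List.foldr _+_ 0# (List.map f (filter X? (vectors 3)))

  -- A multiset over 𝔽_p is its weight function.
  PDivisible : Pred Function 0ℓ
  PDivisible f = ∀ H → sumOver ⟪ H ⟫? f ≡ 0#

  Span : Pred Function 0ℓ → Pred Function 0ℓ
  Span G f =
    ∃ λ n → Σ[ c ∈ Vector 𝔽 n ] Σ[ g ∈ Vector Function n ]
      (∀ i → g i ∈ G) × (f ≗ λ x → ∑[ i < n ] (c i * g i x))

  CylinderFunction : Pred Function 0ℓ
  CylinderFunction g = Σ[ C ∈ Cylinder ] g ≗ 𝟏 (Cylinder.points? C)

  CylinderTypeWeight : Pred Function 0ℓ
  CylinderTypeWeight g =
    Σ[ ℓ ∈ Vector Line p ] PairwiseParallel ℓ × (g ≗ λ x → ∑[ i < p ] 𝟏 ⟦ ℓ i ⟧? x)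

  ParallelDifference : Pred Function 0ℓ
  ParallelDifference g =
    ∃₂ λ ℓ₁ ℓ₂ → ℓ₁ ∥ ℓ₂ × (g ≗ λ x → 𝟏 ⟦ ℓ₁ ⟧? x - 𝟏 ⟦ ℓ₂ ⟧? x)

{-# OPTIONS --safe #-}

-- Dually, the plane conditions say that f is orthogonal to every h(x + s y + t z), hence, taking
-- powers and comparing coefficients in s and t (binomials C(n,k) with n < p are units), to every
-- monomial of degree below p. A subspace V containing the differences of parallel lines of
-- direction (-s, -t, 1) contains h(Λ + e) - h(Λ) for Λ = (x + s z, y + t z) and every h : 𝔽_p² → 𝔽_p,
-- hence the products (x + s z)^i (y + t z)^j with i, j < p not both p - 1, and again by comparing
-- coefficients all monomials x^a y^b z^c with a, b < p and a + b + c ≤ 2p - 3.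
-- The indicator [u = v] on 𝔽_p is a combination of monomials u^i v^j with i + j < p. Substituting
-- this in each coordinate of f(x) = Σ_y f(y) [x = y] yields terms (Σ_y f(y) y^β) x^α with
-- |α| + |β| ≤ 3p - 3: the scalar vanishes if |β| < p, and otherwise |α| ≤ 2p - 3, so x^α ∈ V.
-- Two cylinders sharing all but one line of each differ by a difference of parallel lines, which
-- puts the latter in the span of cylinders.
module Submission where

open import Defs
open import Algebra.Bundles using (CommutativeRing)
import Algebra.Properties.CommutativeSemiring.Binomial as Binomial
import Algebra.Properties.CommutativeSemiring.Exp as Exp
import Algebra.Properties.Group as GroupProperties
import Algebra.Properties.Ring as RingProperties
import Algebra.Properties.Semiring.Mult as Mult
import Algebra.Properties.Semiring.Sum as SemiringSum
import Algebra.Solver.Ring.NaturalCoefficients.Default as Solver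
open import Data.Bool.Base using (if_then_else_)
open import Data.Fin.Base using (Fin; zero; suc; toℕ; fromℕ<)
import Data.Fin.Properties as Fin
open import Data.List.Base as List using (List; []; _∷_; allFin)
open import Data.List.Membership.Propositional as List∈ using ()
open import Data.List.Membership.Propositional.Properties using (∈-allFin; ∈-filter⁺; ∈-filter⁻)
import Data.List.Properties as List
import Data.List.Relation.Unary.All as All
open import Data.List.Relation.Unary.AllPairs using ([]; _∷_)
open import Data.List.Relation.Unary.Any as Any using (here; there)
open import Data.List.Relation.Unary.Unique.Propositional using (Unique)
open import Data.List.Relation.Unary.Unique.Propositional.Properties using (allFin⁺)
open import Data.Nat.Base as ℕ using (ℕ; zero; suc; NonZero)
open import Data.Nat.Combinatorics using (_C_; nCk≡n!/k![n-k]!; k![n∸k]!∣n!)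
open import Data.Nat.Coprimality using (prime⇒coprime; coprime-Bézout)
open import Data.Nat.DivMod using (_%_; %-distribˡ-+; m<n⇒m%n≡m; m/n*n≡m; n%n≡0)
open import Data.Nat.Divisibility using (_∣_; ∣m⇒∣m*n; m%n≡0⇒n∣m; >⇒∤)
import Data.Nat.GCD as GCD
open import Data.Nat.Primality using (Prime; euclidsLemma; prime⇒nonTrivial)
import Data.Nat.Properties as ℕ
open import Data.Nat.Solver using (module +-*-Solver)
open import Data.Product.Base using (∃; _×_; _,_; proj₁; proj₂)
open import Data.Sum.Base using (_⊎_; inj₁; inj₂; [_,_]′)
open import Data.Vec.Base as Vec using (Vec; []; _∷_; zipWith)
open import Data.Vec.Functional as Vector using (Vector)
open import Data.Vec.Properties using (≡-dec)
open import Function.Base using (_∘_)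
open import Level using (0ℓ)
open import Relation.Binary.Definitions using (DecidableEquality)
open import Relation.Binary.PropositionalEquality
open import Relation.Nullary.Decidable using (Dec; yes; no; does; ¬?; _×-dec_)
open import Relation.Nullary.Negation using (¬_; contradiction)
open import Relation.Unary using (Pred; Decidable; _∈_)

-- Degree counts and ring identities

degree-split : ∀ a b k l →
  3 ℕ.+ (a ℕ.+ b ℕ.+ (k ℕ.+ l)) ≡ (suc a ℕ.+ k) ℕ.+ suc (suc (b ℕ.+ l))
degree-split = solve 4 (λ a b k l →
  con 3 :+ (a :+ b :+ (k :+ l)) := (con 1 :+ a :+ k) :+ (con 2 :+ (b :+ l))) refl
  where open +-*-Solver

-- Adds up the three bounds `suc (aᵢ + bᵢ) ≤ p`. The three successors account for the 3 in
-- `|α| ≤ 2p - 3` once `|β| ≥ p` is subtracted.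
exchange-sums : ∀ a₁ a₂ a₃ b₁ b₂ b₃ →
  (suc (a₁ ℕ.+ b₁) ℕ.+ suc (a₂ ℕ.+ b₂)) ℕ.+ suc (a₃ ℕ.+ b₃) ≡
  (3 ℕ.+ (a₁ ℕ.+ a₂ ℕ.+ a₃)) ℕ.+ (b₁ ℕ.+ b₂ ℕ.+ b₃)
exchange-sums = solve 6 (λ a₁ a₂ a₃ b₁ b₂ b₃ →
  ((con 1 :+ (a₁ :+ b₁)) :+ (con 1 :+ (a₂ :+ b₂))) :+ (con 1 :+ (a₃ :+ b₃)) :=
  (con 3 :+ (a₁ :+ a₂ :+ a₃)) :+ (b₁ :+ b₂ :+ b₃)) refl
  where open +-*-Solver

module Identities {c ℓ} (R : CommutativeRing c ℓ) where

  open CommutativeRing R hiding (refl)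
  open CommutativeRing R using () renaming (refl to ≈-refl)
  open Solver commutativeSemiring

  division-step : ∀ g r u e q →
    g + (r + u) * (e + u * q) ≈ (g + r * e) + u * (e + (r + u) * q)
  division-step = solve 5
    (λ g r u e q → g :+ (r :+ u) :* (e :+ u :* q) := (g :+ r :* e) :+ u :* (e :+ (r :+ u) :* q)) ≈-refl

  *-collect : ∀ b l a k → b * l * (a * k) ≈ a * b * (k * l)
  *-collect = solve 4 (λ b l a k → b :* l :* (a :* k) := a :* b :* (k :* l)) ≈-refl

  *-right-swap : ∀ x y z → x * y * z ≈ x * z * y
  *-right-swap = solve 3 (λ x y z → x :* y :* z := x :* z :* y) ≈-refl

  -- Used with `e` equal to `- 1#`: multiplying a monomial by `x - y - c` raises the exponent of
  -- `x`, that of `y`, or neither.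
  factor-expansion : ∀ a b x y e c q →
    a * b * ((x + e * y + e * c) * q) ≈ x * a * b * q + e * (a * (y * b) * q) + e * c * (a * b * q)
  factor-expansion = solve 7 (λ a b x y e c q →
    a :* b :* ((x :+ e :* y :+ e :* c) :* q) :=
    x :* a :* b :* q :+ e :* (a :* (y :* b) :* q) :+ e :* c :* (a :* b :* q)) ≈-refl

  separate : ∀ f a₁ a₂ a₃ b₁ b₂ b₃ →
    f * (a₃ * b₃) * (a₂ * b₂) * (a₁ * b₁) ≈ a₁ * a₂ * a₃ * (f * (b₁ * b₂ * b₃))
  separate = solve 7 (λ f a₁ a₂ a₃ b₁ b₂ b₃ →
    f :* (a₃ :* b₃) :* (a₂ :* b₂) :* (a₁ :* b₁) :=
    a₁ :* a₂ :* a₃ :* (f :* (b₁ :* b₂ :* b₃))) ≈-refl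

  *-swap : ∀ x y z → x * (y * z) ≈ y * (x * z)
  *-swap = solve 3 (λ x y z → x :* (y :* z) := y :* (x :* z)) ≈-refl

  medial : ∀ w x y z → (w + x) + (y + z) ≈ (w + y) + (x + z)
  medial = solve 4 (λ w x y z → (w :+ x) :+ (y :+ z) := (w :+ y) :+ (x :+ z)) ≈-refl

  -- The semiring solver knows no negatives, so `- s` and `- t` enter as independent variables `s′`
  -- and `t′`; the sums `s + s′` and `t + t′` are cancelled afterwards.
  plane-form : ∀ a s t s′ t′ σ τ →
    ((a + (σ * s′ + τ * t′)) + s * (0# + (σ * 1# + τ * 0#))) + t * (0# + (σ * 0# + τ * 1#)) ≈
    a + (σ * (s + s′) + τ * (t + t′))
  plane-form = solve 7 (λ a s t s′ t′ σ τ →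
    ((a :+ (σ :* s′ :+ τ :* t′)) :+ s :* (con 0 :+ (σ :* con 1 :+ τ :* con 0)))
      :+ t :* (con 0 :+ (σ :* con 0 :+ τ :* con 1)) :=
    a :+ (σ :* (s :+ s′) :+ τ :* (t :+ t′))) ≈-refl

  plane-base : ∀ a s t s′ t′ σ τ →
    ((a + s * σ) + t * τ) + (σ * s′ + τ * t′) ≈ a + (σ * (s + s′) + τ * (t + t′))
  plane-base = solve 7 (λ a s t s′ t′ σ τ →
    ((a :+ s :* σ) :+ t :* τ) :+ (σ :* s′ :+ τ :* t′) :=
    a :+ (σ :* (s :+ s′) :+ τ :* (t :+ t′))) ≈-refl

  basis-first : ∀ σ τ → σ * 1# + τ * 0# ≈ σ
  basis-first = solve 2 (λ σ τ → σ :* con 1 :+ τ :* con 0 := σ) ≈-refl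

  basis-second : ∀ σ τ → σ * 0# + τ * 1# ≈ τ
  basis-second = solve 2 (λ σ τ → σ :* con 0 :+ τ :* con 1 := τ) ≈-refl

  line-form : ∀ a s s′ τ → (a + τ * s′) + s * (0# + τ * 1#) ≈ a + τ * (s + s′)
  line-form = solve 4 (λ a s s′ τ →
    (a :+ τ :* s′) :+ s :* (con 0 :+ τ :* con 1) := a :+ τ :* (s :+ s′)) ≈-refl

  line-base : ∀ a s s′ τ → (a + s * τ) + τ * s′ ≈ a + τ * (s + s′)
  line-base = solve 4 (λ a s s′ τ → (a :+ s :* τ) :+ τ :* s′ := a :+ τ :* (s :+ s′)) ≈-refl

  binomial-term : ∀ c t b a w → c * ((t * b) * a) * w ≈ t * (c * (b * a * w))
  binomial-term = solve 5 (λ c t b a w → c :* ((t :* b) :* a) :* w := t :* (c :* (b :* a :* w))) ≈-refl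

module _ (p : ℕ) .{{_ : NonZero p}} (p-prime : Prime p) where

  private
    K : Set
    K = 𝔽 p

  open CommutativeRing (𝔽-commutativeRing p)
    hiding (zero; refl; sym; trans; reflexive; isEquivalence)
  open Identities (𝔽-commutativeRing p)
  open Binomial commutativeSemiring using () renaming (theorem to binomial-theorem)
  open Exp commutativeSemiring using (_^_; ^-distrib-*; ^-homo-*)
  open Mult semiring using (×-assoc-*; ×1-homo-*) renaming (_×_ to _×#_)
  open RingProperties ring using (-‿distribˡ-*; -‿distribʳ-*; -‿+-comm; -1*x≈-x; -0#≈0#)
  open GroupProperties +-group using (inverseˡ-unique)
    renaming (x∙y⁻¹≈ε⇒x≈y to x-y≡0⇒x≡y; //-rightDividesˡ to [y-x]+x≡y; //-rightDividesʳ to [y+x]-x≡y)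
  open SemiringSum semiring using (sum; sum-cong-≗; sum-replicate-zero; *-distribˡ-sum; *-distribʳ-sum)
  open ≡-Reasoning

  1<p : 1 ℕ.< p
  1<p = ℕ.nonTrivial⇒n>1 p {{prime⇒nonTrivial p-prime}}

  -- Arithmetic of 𝔽_p

  -- A multiple of `1#` rather than a remainder, to match the coefficients of the binomial theorem
  -- and to be visibly multiplicative.
  residue : ℕ → K
  residue n = n ×# 1#

  toℕ-residue : ∀ n → toℕ (residue n) ≡ n % p
  toℕ-residue zero    = Fin.toℕ-fromℕ< _
  toℕ-residue (suc n) = begin
    toℕ (1# + residue n)                   ≡⟨ Fin.toℕ-fromℕ< _ ⟩
    (toℕ 1# ℕ.+ toℕ (residue n)) % p       ≡⟨ cong₂ (λ a b → (a ℕ.+ b) % p) (Fin.toℕ-fromℕ< _) (toℕ-residue n) ⟩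
    (1 % p ℕ.+ n % p) % p                  ≡⟨ %-distribˡ-+ 1 n p ⟨
    suc n % p                              ∎

  residue-toℕ : ∀ a → residue (toℕ a) ≡ a
  residue-toℕ a = Fin.toℕ-injective (trans (toℕ-residue (toℕ a)) (m<n⇒m%n≡m (Fin.toℕ<n a)))

  0%p≡0 : 0 % p ≡ 0
  0%p≡0 = m<n⇒m%n≡m (ℕ.>-nonZero⁻¹ p)

  residue≡0⇒∣ : ∀ n → residue n ≡ 0# → p ∣ n
  residue≡0⇒∣ n eq = m%n≡0⇒n∣m n p (begin
    n % p            ≡⟨ toℕ-residue n ⟨
    toℕ (residue n)  ≡⟨ cong toℕ eq ⟩
    toℕ 0#           ≡⟨ toℕ-residue 0 ⟩
    0 % p            ≡⟨ 0%p≡0 ⟩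
    0                ∎)

  residue-p : residue p ≡ 0#
  residue-p = Fin.toℕ-injective (trans (toℕ-residue p)
    (trans (n%n≡0 p) (trans (sym 0%p≡0) (sym (toℕ-residue 0)))))

  1≢0 : 1# ≢ 0#
  1≢0 eq = contradiction (begin
    1                ≡⟨ m<n⇒m%n≡m 1<p ⟨
    1 % p            ≡⟨ toℕ-residue 1 ⟨
    toℕ (1# + 0#)    ≡⟨ cong toℕ (+-identityʳ 1#) ⟩
    toℕ 1#           ≡⟨ cong toℕ eq ⟩
    toℕ 0#           ≡⟨ toℕ-residue 0 ⟩
    0 % p            ≡⟨ 0%p≡0 ⟩
    0                ∎) λ ()

  residue-multiple : ∀ x → residue (x ℕ.* p) ≡ 0#
  residue-multiple x = trans (×1-homo-* x p) (trans (cong (residue x *_) residue-p) (zeroʳ (residue x)))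

  residue-*-toℕ : ∀ x a → residue (x ℕ.* toℕ a) ≡ residue x * a
  residue-*-toℕ x a = trans (×1-homo-* x (toℕ a)) (cong (residue x *_) (residue-toℕ a))

  -- Bézout for the coprime numbers `p` and `toℕ a`. Over the naturals the identity has two sign
  -- patterns; in the second the inverse is the negative of the coefficient.
  invertible : ∀ a → a ≢ 0# → ∃ λ b → b * a ≡ 1#
  invertible a a≢0 = inverse (coprime-Bézout (prime⇒coprime p-prime {{toℕa≢0}} (Fin.toℕ<n a)))
    where
    toℕa≢0 : NonZero (toℕ a)
    toℕa≢0 = ℕ.≢-nonZero λ eq → a≢0 (trans (sym (residue-toℕ a)) (cong residue eq))

    inverse : GCD.Bézout.Identity 1 p (toℕ a) → ∃ λ b → b * a ≡ 1#
    inverse (GCD.Bézout.-+ x y eq) = residue y , (begin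
      residue y * a               ≡⟨ residue-*-toℕ y a ⟨
      residue (y ℕ.* toℕ a)       ≡⟨ cong residue eq ⟨
      1# + residue (x ℕ.* p)      ≡⟨ cong (1# +_) (residue-multiple x) ⟩
      1# + 0#                     ≡⟨ +-identityʳ 1# ⟩
      1#                          ∎)
    inverse (GCD.Bézout.+- x y eq) = - residue y , (begin
      - residue y * a             ≡⟨ -‿distribˡ-* (residue y) a ⟨
      - (residue y * a)           ≡⟨ inverseˡ-unique 1# (residue y * a) (begin
        1# + residue y * a          ≡⟨ cong (1# +_) (residue-*-toℕ y a) ⟨
        residue (1 ℕ.+ y ℕ.* toℕ a) ≡⟨ cong residue eq ⟩
        residue (x ℕ.* p)           ≡⟨ residue-multiple x ⟩
        0#                          ∎) ⟨
      1#                          ∎)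

  integral : ∀ {a b} → a ≢ 0# → b ≢ 0# → a * b ≢ 0#
  integral {a} {b} a≢0 b≢0 ab≡0 = b≢0 (begin
    b              ≡⟨ *-identityˡ b ⟨
    1# * b         ≡⟨ cong (_* b) (proj₂ a⁻¹) ⟨
    (c * a) * b    ≡⟨ *-assoc c a b ⟩
    c * (a * b)    ≡⟨ cong (c *_) ab≡0 ⟩
    c * 0#         ≡⟨ zeroʳ c ⟩
    0#             ∎)
    where
    a⁻¹ = invertible a a≢0
    c   = proj₁ a⁻¹

  p∤n! : ∀ n → n ℕ.< p → ¬ (p ∣ n ℕ.!)
  p∤n! zero    _   p∣1 = >⇒∤ 1<p p∣1
  p∤n! (suc n) n<p p∣  = [ >⇒∤ n<p , p∤n! n (ℕ.<-trans (ℕ.n<1+n n) n<p) ]′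
    (euclidsLemma (suc n) (n ℕ.!) p-prime p∣)

  -- The binomial coefficient divides `n !`, a product of factors smaller than `p`.
  binomial≢0 : ∀ {n k} → k ℕ.≤ n → n ℕ.< p → residue (n C k) ≢ 0#
  binomial≢0 {n} {k} k≤n n<p eq = p∤n! n n<p (subst (p ∣_) n!-factored
      (∣m⇒∣m*n d (residue≡0⇒∣ (n C k) eq)))
    where
    d = k ℕ.! ℕ.* (n ℕ.∸ k) ℕ.!
    instance
      d≢0 : NonZero d
      d≢0 = k ℕ.!* (n ℕ.∸ k) !≢0
    n!-factored : (n C k) ℕ.* d ≡ n ℕ.!
    n!-factored = trans (cong (ℕ._* d) (nCk≡n!/k![n-k]! k≤n)) (m/n*n≡m (k![n∸k]!∣n! k≤n))

  -- Subspaces of K-valued functions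

  -- Kept abstract so that the same extraction of coefficients applies to the annihilator of `f`, to
  -- the spans and to preimages of these. `≗-closed` takes the place of function extensionality.
  record Subspace (X : Set) : Set₁ where
    field
      ⟨_⟩      : Pred (X → K) 0ℓ
      ≗-closed     : ∀ {g h} → g ≗ h → g ∈ ⟨_⟩ → h ∈ ⟨_⟩
      0-closed : (λ _ → 0#) ∈ ⟨_⟩
      +-closed : ∀ {g h} → g ∈ ⟨_⟩ → h ∈ ⟨_⟩ → (λ x → g x + h x) ∈ ⟨_⟩
      *-closed : ∀ c {g} → g ∈ ⟨_⟩ → (λ x → c * g x) ∈ ⟨_⟩

    minus-closed : ∀ {g h} → g ∈ ⟨_⟩ → h ∈ ⟨_⟩ → (λ x → g x - h x) ∈ ⟨_⟩
    minus-closed {g} {h} g∈ h∈ = ≗-closed (λ x → cong (g x +_) (-1*x≈-x (h x)))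
      (+-closed g∈ (*-closed (- 1#) h∈))

    *-cancel : ∀ {c} → c ≢ 0# → ∀ {g} → (λ x → c * g x) ∈ ⟨_⟩ → g ∈ ⟨_⟩
    *-cancel {c} c≢0 {g} cg∈ with invertible c c≢0
    ... | d , dc≡1 = ≗-closed (λ x → begin
      d * (c * g x)   ≡⟨ *-assoc d c (g x) ⟨
      (d * c) * g x   ≡⟨ cong (_* g x) dc≡1 ⟩
      1# * g x        ≡⟨ *-identityˡ (g x) ⟩
      g x             ∎) (*-closed d cg∈)

  open Subspace

  record Linear {X Y : Set} (φ : (X → K) → Y → K) : Set where
    field
      φ-cong : ∀ {g h} → g ≗ h → φ g ≗ φ h
      φ-+    : ∀ g h → φ (λ x → g x + h x) ≗ (λ y → φ g y + φ h y)
      φ-*    : ∀ c g → φ (λ x → c * g x) ≗ (λ y → c * φ g y)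

    φ-0 : φ (λ _ → 0#) ≗ (λ _ → 0#)
    φ-0 y = begin
      φ (λ _ → 0#) y           ≡⟨ φ-cong (λ _ → sym (zeroˡ 0#)) y ⟩
      φ (λ _ → 0# * 0#) y      ≡⟨ φ-* 0# (λ _ → 0#) y ⟩
      0# * φ (λ _ → 0#) y      ≡⟨ zeroˡ _ ⟩
      0#                       ∎

  preimage : ∀ {X Y} {φ : (X → K) → Y → K} → Linear φ → Subspace Y → Subspace X
  preimage {φ = φ} φ-linear V = record
    { ⟨_⟩      = λ g → φ g ∈ ⟨ V ⟩
    ; ≗-closed     = λ g≗h → ≗-closed V (φ-cong g≗h)
    ; 0-closed = ≗-closed V (sym ∘ φ-0) (0-closed V)
    ; +-closed = λ {g} {h} g∈ h∈ → ≗-closed V (sym ∘ φ-+ g h) (+-closed V g∈ h∈)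
    ; *-closed = λ c {g} g∈ → ≗-closed V (sym ∘ φ-* c g) (*-closed V c g∈)
    }
    where open Linear φ-linear

  ∘-linear : ∀ {X Y} (F : Y → X) → Linear (_∘ F)
  ∘-linear F = record
    { φ-cong = λ g≗h → g≗h ∘ F ; φ-+ = λ _ _ _ → refl ; φ-* = λ _ _ _ → refl }

  difference-linear : ∀ {X Y} (F G : Y → X) → Linear (λ g y → g (F y) - g (G y))
  difference-linear F G = record
    { φ-cong = λ g≗h y → cong₂ _-_ (g≗h (F y)) (g≗h (G y))
    ; φ-+    = λ g h y → begin
        (g (F y) + h (F y)) - (g (G y) + h (G y))        ≡⟨ cong ((g (F y) + h (F y)) +_) (-‿+-comm (g (G y)) (h (G y))) ⟨
        (g (F y) + h (F y)) + (- g (G y) + - h (G y))    ≡⟨ medial (g (F y)) (h (F y)) (- g (G y)) (- h (G y)) ⟩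
        (g (F y) - g (G y)) + (h (F y) - h (G y))        ∎
    ; φ-*    = λ c g y → begin
        c * g (F y) - c * g (G y)       ≡⟨ cong (c * g (F y) +_) (-‿distribʳ-* c (g (G y))) ⟩
        c * g (F y) + c * - g (G y)     ≡⟨ distribˡ c _ _ ⟨
        c * (g (F y) - g (G y))         ∎
    }

  -- Finite sums

  ∑ₗ : {A : Set} → List A → (A → K) → K
  ∑ₗ xs g = List.foldr _+_ 0# (List.map g xs)

  ∑ₗ-cong : ∀ {A} (xs : List A) {g h} → g ≗ h → ∑ₗ xs g ≡ ∑ₗ xs h
  ∑ₗ-cong []       g≗h = refl
  ∑ₗ-cong (x ∷ xs) g≗h = cong₂ _+_ (g≗h x) (∑ₗ-cong xs g≗h)

  ∑ₗ-+ : ∀ {A} (xs : List A) g h → ∑ₗ xs (λ a → g a + h a) ≡ ∑ₗ xs g + ∑ₗ xs h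
  ∑ₗ-+ []       g h = sym (+-identityˡ 0#)
  ∑ₗ-+ (x ∷ xs) g h = trans (cong (g x + h x +_) (∑ₗ-+ xs g h)) (medial (g x) (h x) (∑ₗ xs g) (∑ₗ xs h))

  ∑ₗ-* : ∀ {A} (xs : List A) c g → ∑ₗ xs (λ a → c * g a) ≡ c * ∑ₗ xs g
  ∑ₗ-* []       c g = sym (zeroʳ c)
  ∑ₗ-* (x ∷ xs) c g = trans (cong (c * g x +_) (∑ₗ-* xs c g)) (sym (distribˡ c _ _))

  ∑ₗ-0 : ∀ {A} (xs : List A) {g} → (∀ {a} → a List∈.∈ xs → g a ≡ 0#) → ∑ₗ xs g ≡ 0#
  ∑ₗ-0 []       g≡0 = refl
  ∑ₗ-0 (x ∷ xs) g≡0 = trans (cong₂ _+_ (g≡0 (here refl)) (∑ₗ-0 xs (g≡0 ∘ there))) (+-identityˡ 0#)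

  ∑ₗ-single : ∀ {A} {xs : List A} {a} → Unique xs → a List∈.∈ xs →
              ∀ {g} → (∀ b → b ≢ a → g b ≡ 0#) → ∑ₗ xs g ≡ g a
  ∑ₗ-single {xs = x ∷ xs} {a} (x∉xs ∷ _) (here a≡x) {g} g≡0 = begin
    g x + ∑ₗ xs g   ≡⟨ cong₂ (λ y s → g y + s) (sym a≡x) (∑ₗ-0 xs λ {b} b∈xs →
                         g≡0 b λ b≡a → All.lookup x∉xs b∈xs (trans (sym a≡x) (sym b≡a))) ⟩
    g a + 0#        ≡⟨ +-identityʳ (g a) ⟩
    g a             ∎
  ∑ₗ-single {xs = x ∷ xs} {a} (x∉xs ∷ unique) (there a∈xs) {g} g≡0 = begin
    g x + ∑ₗ xs g   ≡⟨ cong₂ _+_ (g≡0 x (All.lookup x∉xs a∈xs)) (∑ₗ-single unique a∈xs g≡0) ⟩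
    0# + g a        ≡⟨ +-identityˡ (g a) ⟩
    g a             ∎

  ∑ₗ-closed : ∀ {X A} (V : Subspace X) (xs : List A) {G : A → X → K} →
              (∀ a → G a ∈ ⟨ V ⟩) → (λ x → ∑ₗ xs (λ a → G a x)) ∈ ⟨ V ⟩
  ∑ₗ-closed V []       G∈ = 0-closed V
  ∑ₗ-closed V (a ∷ as) G∈ = +-closed V (G∈ a) (∑ₗ-closed V as G∈)

  -- Iverson brackets

  𝟙[_] : {P : Set} → Dec P → K
  𝟙[ P? ] = if does P? then 1# else 0#

  bracket-yes : ∀ {P} (P? : Dec P) → P → 𝟙[ P? ] ≡ 1#
  bracket-yes (yes _) _ = refl
  bracket-yes (no ¬P) P = contradiction P ¬P

  bracket-no : ∀ {P} (P? : Dec P) → ¬ P → 𝟙[ P? ] ≡ 0#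
  bracket-no (yes P) ¬P = contradiction P ¬P
  bracket-no (no _)  _  = refl

  bracket-cong : ∀ {P Q} (P? : Dec P) (Q? : Dec Q) → (P → Q) → (Q → P) → 𝟙[ P? ] ≡ 𝟙[ Q? ]
  bracket-cong P? (yes Q) _ Q⇒P = bracket-yes P? (Q⇒P Q)
  bracket-cong P? (no ¬Q) P⇒Q _ = bracket-no P? (¬Q ∘ P⇒Q)

  bracket-⊎ : ∀ {P Q R} (P? : Dec P) (Q? : Dec Q) (R? : Dec R) → (P → Q ⊎ R) → (Q → P) → (R → P) →
              (Q → ¬ R) → 𝟙[ P? ] ≡ 𝟙[ Q? ] + 𝟙[ R? ]
  bracket-⊎ P? (yes Q) R? _ Q⇒P _ Q⇒¬R = begin
    𝟙[ P? ]         ≡⟨ bracket-yes P? (Q⇒P Q) ⟩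
    1#              ≡⟨ +-identityʳ 1# ⟨
    1# + 0#         ≡⟨ cong (1# +_) (bracket-no R? (Q⇒¬R Q)) ⟨
    1# + 𝟙[ R? ]    ∎
  bracket-⊎ P? (no ¬Q) R? P⇒Q⊎R _ R⇒P _ = begin
    𝟙[ P? ]         ≡⟨ bracket-cong P? R? ([ (λ Q → contradiction Q ¬Q) , (λ r → r) ]′ ∘ P⇒Q⊎R) R⇒P ⟩
    𝟙[ R? ]         ≡⟨ +-identityˡ 𝟙[ R? ] ⟨
    0# + 𝟙[ R? ]    ∎

  ∑ₗ-filter : ∀ {A} {P : Pred A 0ℓ} (P? : Decidable P) g xs →
              ∑ₗ (List.filter P? xs) g ≡ ∑ₗ xs (λ x → g x * 𝟙[ P? x ])
  ∑ₗ-filter P? g []       = refl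
  ∑ₗ-filter P? g (x ∷ xs) with P? x
  ... | yes _ = cong₂ _+_ (sym (*-identityʳ (g x))) (∑ₗ-filter P? g xs)
  ... | no  _ = trans (∑ₗ-filter P? g xs)
                      (sym (trans (cong (_+ _) (zeroʳ (g x))) (+-identityˡ _)))

  -- Applied to preimages under linear maps, this reduces a claim about all functions on a finite
  -- set to one about indicators of points.
  point-masses-span : ∀ {X} (_≟ˣ_ : DecidableEquality X) {xs : List X} →
    Unique xs → (∀ x → x List∈.∈ xs) → (V : Subspace X) →
    (∀ a → (λ x → 𝟙[ x ≟ˣ a ]) ∈ ⟨ V ⟩) → ∀ g → g ∈ ⟨ V ⟩
  point-masses-span _≟ˣ_ {xs} unique complete V masses∈ g =
    ≗-closed V expansion (∑ₗ-closed V xs (λ a → *-closed V (g a) (masses∈ a)))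
    where
    expansion : (λ x → ∑ₗ xs (λ a → g a * 𝟙[ x ≟ˣ a ])) ≗ g
    expansion x = begin
      ∑ₗ xs (λ a → g a * 𝟙[ x ≟ˣ a ])   ≡⟨ ∑ₗ-single unique (complete x) (λ b b≢x →
                                              trans (cong (g b *_) (bracket-no (x ≟ˣ b) (b≢x ∘ sym))) (zeroʳ (g b))) ⟩
      g x * 𝟙[ x ≟ˣ x ]                 ≡⟨ cong (g x *_) (bracket-yes (x ≟ˣ x) refl) ⟩
      g x * 1#                          ≡⟨ *-identityʳ (g x) ⟩
      g x                               ∎

  -- Polynomials in a scalar parameter with coefficients in a function space

  horner : ∀ {X : Set} {n} → Vector (X → K) n → K → X → K
  horner {n = zero}  g t x = 0#
  horner {n = suc n} g t x = g zero x + t * horner (g ∘ suc) t x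

  horner-sum : ∀ {X : Set} {n} (g : Vector (X → K) n) t x → horner g t x ≡ sum (λ k → t ^ toℕ k * g k x)
  horner-sum {n = zero}  g t x = refl
  horner-sum {n = suc n} g t x = cong₂ _+_ (sym (*-identityˡ (g zero x))) (begin
    t * horner (g ∘ suc) t x                         ≡⟨ cong (t *_) (horner-sum (g ∘ suc) t x) ⟩
    t * sum (λ k → t ^ toℕ k * g (suc k) x)          ≡⟨ *-distribˡ-sum t (λ k → t ^ toℕ k * g (suc k) x) ⟩
    sum (λ k → t * (t ^ toℕ k * g (suc k) x))        ≡⟨ sum-cong-≗ (λ k → sym (*-assoc t (t ^ toℕ k) (g (suc k) x))) ⟩
    sum (λ k → t ^ toℕ (suc k) * g (suc k) x)        ∎)

  -- Synthetic division by t - r.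
  quotient : ∀ {X : Set} {n} → Vector (X → K) (suc n) → K → Vector (X → K) n
  quotient {n = suc n} g r zero    = horner (g ∘ suc) r
  quotient {n = suc n} g r (suc k) = quotient (g ∘ suc) r k

  -- Division with remainder at the point `t = r + u`; naming the difference `u` keeps the identity
  -- free of subtraction.
  horner-quotient : ∀ {X : Set} {n} (g : Vector (X → K) (suc n)) r u x →
    horner g (r + u) x ≡ horner g r x + u * horner (quotient g r) (r + u) x
  horner-quotient {n = zero} g r u x = begin
    g zero x + (r + u) * 0#             ≡⟨ cong (g zero x +_) (zeroʳ (r + u)) ⟩
    g zero x + 0#                       ≡⟨ cong (g zero x +_) (zeroʳ r) ⟨
    g zero x + r * 0#                   ≡⟨ +-identityʳ _ ⟨
    g zero x + r * 0# + 0#              ≡⟨ cong (g zero x + r * 0# +_) (zeroʳ u) ⟨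
    g zero x + r * 0# + u * 0#          ∎
  horner-quotient {n = suc n} g r u x = trans
    (cong (λ s → g zero x + (r + u) * s) (horner-quotient (g ∘ suc) r u x))
    (division-step (g zero x) r u (horner (g ∘ suc) r x) (horner (quotient (g ∘ suc) r) (r + u) x))

  module _ {X : Set} (V : Subspace X) where

    -- `quotient g r zero` is the value at `r` of the tail of `g`. It isolates `g zero` from
    -- `horner g r`, and it is the value required for the recursion on the tail.
    quotient-closed : ∀ {n} (g : Vector (X → K) (suc n)) r → horner g r ∈ ⟨ V ⟩ →
                      (∀ k → quotient g r k ∈ ⟨ V ⟩) → ∀ k → g k ∈ ⟨ V ⟩
    quotient-closed {zero}  g r gr∈ q∈ zero    =
      ≗-closed V (λ x → trans (cong (g zero x +_) (zeroʳ r)) (+-identityʳ (g zero x))) gr∈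
    quotient-closed {suc n} g r gr∈ q∈ zero    =
      ≗-closed V (λ x → [y+x]-x≡y (r * horner (g ∘ suc) r x) (g zero x))
        (minus-closed V gr∈ (*-closed V r (q∈ zero)))
    quotient-closed {suc n} g r gr∈ q∈ (suc k) =
      quotient-closed (g ∘ suc) r (q∈ zero) (q∈ ∘ suc) k

    -- Interpolation by eliminating one node at a time: subtracting the value at `r` and dividing by
    -- `t - r` gives values of the quotient, which has one coefficient fewer.
    coefficients-closed : ∀ {n ts} (g : Vector (X → K) n) → Unique ts → n ℕ.≤ List.length ts →
                          (∀ {t} → t List∈.∈ ts → horner g t ∈ ⟨ V ⟩) → ∀ k → g k ∈ ⟨ V ⟩
    coefficients-closed {suc n} {r ∷ ts} g (r∉ts ∷ unique) (ℕ.s≤s n≤) g∈ =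
      quotient-closed g r (g∈ (here refl))
        (coefficients-closed (quotient g r) unique n≤ λ {t} t∈ts →
          *-cancel V {t - r} (t-r≢0 (All.lookup r∉ts t∈ts))
            (≗-closed V (λ x → division r t (horner g r x) (expand r t x))
              (minus-closed V (g∈ (there t∈ts)) (g∈ (here refl)))))
      where
      r+[t-r] : ∀ r t → r + (t - r) ≡ t
      r+[t-r] r t = trans (+-comm r (t - r)) ([y-x]+x≡y r t)
      t-r≢0 : ∀ {r t} → r ≢ t → t - r ≢ 0#
      t-r≢0 {r} {t} r≢t t-r≡0 = r≢t (sym (x-y≡0⇒x≡y t r t-r≡0))
      expand : ∀ r t x → horner g t x ≡ horner g r x + (t - r) * horner (quotient g r) t x
      expand r t x = subst (λ s → horner g s x ≡ horner g r x + (t - r) * horner (quotient g r) s x)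
        (r+[t-r] r t) (horner-quotient g r (t - r) x)
      division : ∀ r t a {b q} → b ≡ a + (t - r) * q → b - a ≡ (t - r) * q
      division r t a {b} {q} refl =
        trans (cong (_- a) (+-comm a ((t - r) * q))) ([y+x]-x≡y a ((t - r) * q))

    -- As a polynomial in `t`, the power has `i + j + 1 ≤ p` coefficients, so the `p` scalars
    -- suffice for interpolation. The coefficient of `t ^ j` is the desired product times a binomial
    -- coefficient, which is a unit.
    polarise : ∀ (A B w : X → K) i j → i ℕ.+ j ℕ.< p →
               (∀ t → (λ x → (A x + t * B x) ^ (i ℕ.+ j) * w x) ∈ ⟨ V ⟩) →
               (λ x → A x ^ i * B x ^ j * w x) ∈ ⟨ V ⟩
    polarise A B w i j n<p powers∈ = ≗-closed V coefficient-j
        (*-cancel V (binomial≢0 (ℕ.≤-pred (Fin.toℕ<n k)) n<p)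
          (coefficients-closed g (allFin⁺ p) n<length
            (λ {t} _ → ≗-closed V (expand t) (powers∈ t)) k))
      where
      n = i ℕ.+ j
      g : Vector (X → K) (suc n)
      g k x = residue (n C toℕ k) * (B x ^ toℕ k * A x ^ (n ℕ.∸ toℕ k) * w x)
      k : Fin (suc n)
      k = fromℕ< (ℕ.s≤s (ℕ.m≤n+m j i))
      n<length : n ℕ.< List.length (allFin p)
      n<length = subst (n ℕ.<_) (sym (List.length-tabulate {n = p} (λ a → a))) n<p
      coefficient-j : ∀ x → B x ^ toℕ k * A x ^ (n ℕ.∸ toℕ k) * w x ≡ A x ^ i * B x ^ j * w x
      coefficient-j x rewrite Fin.toℕ-fromℕ< (ℕ.s≤s (ℕ.m≤n+m j i)) | ℕ.m+n∸n≡m i j =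
        cong (_* w x) (*-comm (B x ^ j) (A x ^ i))
      expand : ∀ t x → (A x + t * B x) ^ n * w x ≡ horner g t x
      expand t x = begin
        (A x + t * B x) ^ n * w x        ≡⟨ cong (λ s → s ^ n * w x) (+-comm (A x) (t * B x)) ⟩
        (t * B x + A x) ^ n * w x        ≡⟨ cong (_* w x) (binomial-theorem n (t * B x) (A x)) ⟩
        sum term * w x                   ≡⟨ *-distribʳ-sum (w x) term ⟩
        sum (λ k → term k * w x)         ≡⟨ sum-cong-≗ regroup ⟩
        sum (λ k → t ^ toℕ k * g k x)    ≡⟨ horner-sum g t x ⟨
        horner g t x                     ∎
        where
        term : Vector K (suc n)
        term k = (n C toℕ k) ×# ((t * B x) ^ toℕ k * A x ^ (n ℕ.∸ toℕ k))
        regroup : ∀ k → term k * w x ≡ t ^ toℕ k * g k x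
        regroup k = begin
          c ×# (y ^ m * a) * w x                    ≡⟨ cong (λ s → c ×# s * w x) (*-identityˡ (y ^ m * a)) ⟨
          c ×# (1# * (y ^ m * a)) * w x             ≡⟨ cong (_* w x) (×-assoc-* c 1# (y ^ m * a)) ⟨
          residue c * (y ^ m * a) * w x             ≡⟨ cong (λ s → residue c * (s * a) * w x) (^-distrib-* t (B x) m) ⟩
          residue c * (t ^ m * B x ^ m * a) * w x   ≡⟨ binomial-term (residue c) (t ^ m) (B x ^ m) a (w x) ⟩
          t ^ m * g k x                             ∎
          where
          m = toℕ k
          c = n C m
          y = t * B x
          a = A x ^ (n ℕ.∸ m)

  -- The linear coefficient in u is extracted by polarise on the space Y × K, where u times the
  -- second coordinate is a linear form with values u at 1 and 0 at 0.
  derivative : ∀ {Y} (V : Subspace Y) (A w : Y → K) i → suc i ℕ.< p →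
    (∀ u → (λ y → (A y + u) ^ suc i * w y - A y ^ suc i * w y) ∈ ⟨ V ⟩) →
    (λ y → A y ^ i * w y) ∈ ⟨ V ⟩
  derivative {Y} V A w i i+1<p differences∈ = ≗-closed V (λ y → linear-coefficient (A y ^ i) (w y))
    (polarise W (A ∘ proj₁) proj₂ (w ∘ proj₁) i 1 (subst (ℕ._< p) (ℕ.+-comm 1 i) i+1<p) λ u →
      ≗-closed V (λ y → cong₂ (λ n (a , b) → a ^ n * w y - b ^ n * w y) (ℕ.+-comm 1 i)
          (cong₂ _,_ (cong (A y +_) (sym (*-identityʳ u)))
                     (sym (trans (cong (A y +_) (zeroʳ u)) (+-identityʳ (A y))))))
        (differences∈ u))
    where
    W : Subspace (Y × K)
    W = preimage (difference-linear (_, 1#) (_, 0#)) V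
    linear-coefficient : ∀ a b → a * 1# ^ 1 * b - a * 0# ^ 1 * b ≡ a * b
    linear-coefficient a b = begin
      a * (1# * 1#) * b - a * (0# * 1#) * b    ≡⟨ cong₂ (λ c d → a * c * b - a * d * b) (*-identityʳ 1#) (zeroˡ 1#) ⟩
      a * 1# * b - a * 0# * b                  ≡⟨ cong₂ (λ c d → c * b - d * b) (*-identityʳ a) (zeroʳ a) ⟩
      a * b - 0# * b                           ≡⟨ cong (λ c → a * b - c) (zeroˡ b) ⟩
      a * b - 0#                               ≡⟨ cong (a * b +_) -0#≈0# ⟩
      a * b + 0#                               ≡⟨ +-identityʳ (a * b) ⟩
      a * b                                    ∎

  -- Monomials of degree below p

  x₁ x₂ x₃ : Point p → K
  x₁ (a ∷ _)         = a
  x₂ (_ ∷ a ∷ _)     = a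
  x₃ (_ ∷ _ ∷ a ∷ _) = a

  vanish₁ : ∀ a s τ → a + τ * (s - s) ≡ a
  vanish₁ a s τ = begin
    a + τ * (s - s)   ≡⟨ cong (λ z → a + τ * z) (-‿inverseʳ s) ⟩
    a + τ * 0#        ≡⟨ cong (a +_) (zeroʳ τ) ⟩
    a + 0#            ≡⟨ +-identityʳ a ⟩
    a                 ∎

  vanish₂ : ∀ a s t σ τ → a + (σ * (s - s) + τ * (t - t)) ≡ a
  vanish₂ a s t σ τ = begin
    a + (σ * (s - s) + τ * (t - t))   ≡⟨ cong (a +_) (vanish₁ (σ * (s - s)) t τ) ⟩
    a + σ * (s - s)                   ≡⟨ vanish₁ a s σ ⟩
    a                                 ∎

  planar : K → K → Point p → K
  planar s t x = x₁ x + s * x₂ x + t * x₃ x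

  -- The level set of `planar s t` at `a`, with the second and third coordinates as parameters.
  plane : K → K → K → Plane p
  plane s t a = record
    { base        = a ∷ 0# ∷ 0# ∷ []
    ; u           = - s ∷ 1# ∷ 0# ∷ []
    ; v           = - t ∷ 0# ∷ 1# ∷ []
    ; independent = λ σ τ eq →
        trans (sym (basis-first σ τ)) (cong x₂ eq) , trans (sym (basis-second σ τ)) (cong x₃ eq)
    }

  plane⇒planar : ∀ s t a x → x ∈ ⟪_⟫ p (plane s t a) → planar s t x ≡ a
  plane⇒planar s t a _ (σ , τ , refl) =
    trans (plane-form a s t (- s) (- t) σ τ) (vanish₂ a s t σ τ)

  planar⇒plane : ∀ s t a x → planar s t x ≡ a → x ∈ ⟪_⟫ p (plane s t a)
  planar⇒plane s t _ (a ∷ b ∷ c ∷ []) refl = b , c ,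
    cong₂ _∷_ (sym (trans (plane-base a s t (- s) (- t) b c) (vanish₂ a s t b c)))
      (cong₂ _∷_ (sym (trans (+-identityˡ _) (basis-first b c)))
        (cong (_∷ []) (sym (trans (+-identityˡ _) (basis-second b c)))))

  -- The orthogonal complement of `f` under the pairing that sums products over all points. Being a
  -- subspace, it admits `polarise`.
  annihilator : Function p → Subspace (Point p)
  annihilator f = record
    { ⟨_⟩      = λ g → ∑ₗ points (λ x → f x * g x) ≡ 0#
    ; ≗-closed = λ g≗h → trans (∑ₗ-cong points λ x → cong (f x *_) (sym (g≗h x)))
    ; 0-closed = ∑ₗ-0 points λ {x} _ → zeroʳ (f x)
    ; +-closed = λ {g} {h} g∈ h∈ → begin
        ∑ₗ points (λ x → f x * (g x + h x))                       ≡⟨ ∑ₗ-cong points (λ x → distribˡ (f x) (g x) (h x)) ⟩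
        ∑ₗ points (λ x → f x * g x + f x * h x)                   ≡⟨ ∑ₗ-+ points (λ x → f x * g x) (λ x → f x * h x) ⟩
        ∑ₗ points (λ x → f x * g x) + ∑ₗ points (λ x → f x * h x) ≡⟨ cong₂ _+_ g∈ h∈ ⟩
        0# + 0#                                                   ≡⟨ +-identityˡ 0# ⟩
        0#                                                        ∎
    ; *-closed = λ c {g} g∈ → begin
        ∑ₗ points (λ x → f x * (c * g x))     ≡⟨ ∑ₗ-cong points (λ x → *-swap (f x) c (g x)) ⟩
        ∑ₗ points (λ x → c * (f x * g x))     ≡⟨ ∑ₗ-* points c (λ x → f x * g x) ⟩
        c * ∑ₗ points (λ x → f x * g x)       ≡⟨ cong (c *_) g∈ ⟩
        c * 0#                                ≡⟨ zeroʳ c ⟩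
        0#                                    ∎
    }
    where points = vectors p 3

  -- Start from powers of `x₁ + s x₂ + t x₃`: the inner polarisation, in `t`, splits off `x₃ ^ k`,
  -- and the outer one, in `s`, separates `x₁` from `x₂`.
  low-degree-annihilates : ∀ {f} → f ∈ PDivisible p → ∀ i j k → i ℕ.+ j ℕ.+ k ℕ.< p →
    (λ x → x₁ x ^ i * x₂ x ^ j * x₃ x ^ k) ∈ ⟨ annihilator f ⟩
  low-degree-annihilates {f} f-divisible i j k deg<p =
    polarise V x₁ x₂ (λ x → x₃ x ^ k) i j (ℕ.m+n≤o⇒m≤o (suc (i ℕ.+ j)) deg<p) λ s →
      ≗-closed V (λ x → *-identityʳ _)
        (polarise V (λ x → x₁ x + s * x₂ x) x₃ (λ _ → 1#) (i ℕ.+ j) k deg<p λ t →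
          planar∈ s t (λ a → a ^ (i ℕ.+ j ℕ.+ k) * 1#))
    where
    V = annihilator f
    -- When `h` is a point mass, `h ∘ planar s t` is the indicator of a plane and divisibility
    -- applies; point masses span all `h`.
    planar∈ : ∀ s t h → (h ∘ planar s t) ∈ ⟨ V ⟩
    planar∈ s t = point-masses-span Fin._≟_ (allFin⁺ p) ∈-allFin
      (preimage (∘-linear (planar s t)) V) λ a →
        trans (∑ₗ-cong (vectors p 3) λ x → cong (f x *_)
                (bracket-cong (planar s t x Fin.≟ a) (⟪_⟫? p (plane s t a) x)
                  (planar⇒plane s t a x) (plane⇒planar s t a x)))
          (trans (sym (∑ₗ-filter (⟪_⟫? p (plane s t a)) f (vectors p 3)))
            (f-divisible (plane s t a)))

  -- Functions constant along a direction (-s, -t, 1)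

  K² : Set
  K² = Vec K 2

  _≟²_ : DecidableEquality K²
  _≟²_ = ≡-dec Fin._≟_

  L₁ L₂ : K → Point p → K
  L₁ s x = x₁ x + s * x₃ x
  L₂ t x = x₂ x + t * x₃ x

  -- The quotient map by the direction `(-s, -t, 1)`; its fibres are the lines with this direction.
  Λ : K → K → Point p → K²
  Λ s t x = L₁ s x ∷ L₂ t x ∷ []

  -- Greedy choice: `a` receives all of `c` if the sum stays below `p - 1`. Otherwise `a` is filled
  -- up to exactly `p - 1`, and the degree bound leaves `b + l ≤ p - 2`.
  split-exponent : ∀ a b c → a ℕ.< p → b ℕ.< p → 3 ℕ.+ (a ℕ.+ b ℕ.+ c) ℕ.≤ p ℕ.+ p →
    ∃ λ k → ∃ λ l → c ≡ k ℕ.+ l × a ℕ.+ k ℕ.< p × b ℕ.+ l ℕ.< p ×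
      (suc (a ℕ.+ k) ℕ.< p ⊎ suc (b ℕ.+ l) ℕ.< p)
  split-exponent a b c a<p b<p deg≤ with suc (a ℕ.+ c) ℕ.<? p
  ... | yes a+c+1<p = c , 0 , sym (ℕ.+-identityʳ c) , ℕ.<-trans (ℕ.n<1+n _) a+c+1<p ,
                      subst (ℕ._< p) (sym (ℕ.+-identityʳ b)) b<p , inj₁ a+c+1<p
  ... | no  a+c+1≮p with ℕ.m≤n⇒∃[o]m+o≡n a<p
  ...   | k , refl with ℕ.m≤n⇒∃[o]m+o≡n (ℕ.+-cancelˡ-≤ (suc a) k c (ℕ.≮⇒≥ a+c+1≮p))
  ...     | l , refl = k , l , refl , ℕ.≤-refl , ℕ.<-trans (ℕ.n<1+n _) b+l+1<p , inj₂ b+l+1<p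
    where
    b+l+1<p : suc (b ℕ.+ l) ℕ.< suc a ℕ.+ k
    -- Matching on `refl` has turned `p` into `suc a + k`; one copy of it is cancelled from both
    -- sides of the degree bound.
    b+l+1<p = ℕ.+-cancelˡ-≤ (suc a ℕ.+ k) _ _ (subst (ℕ._≤ (suc a ℕ.+ k) ℕ.+ (suc a ℕ.+ k))
      (degree-split a b k l) deg≤)

  -- The common interface of the two target spans, stated for fibres of `Λ s t` so that functions on
  -- `K²` can be pulled back directly.
  ContainsLineDifferences : Subspace (Point p) → Set
  ContainsLineDifferences V = ∀ s t v w →
    (λ x → 𝟙[ Λ s t x ≟² v ] - 𝟙[ Λ s t x ≟² w ]) ∈ ⟨ V ⟩

  module _ (V : Subspace (Point p)) (lines∈ : ContainsLineDifferences V) where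

    -- By linearity in `h`, a point mass at `w` suffices; it yields the difference of the lines over
    -- `w - e` and `w`.
    shift-difference : ∀ s t e (h : K² → K) →
      (λ x → h (zipWith _+_ (Λ s t x) e) - h (Λ s t x)) ∈ ⟨ V ⟩
    shift-difference s t e = point-masses-span _≟²_ (vectors-unique p 2) (vectors-complete p)
      (preimage (difference-linear (λ x → zipWith _+_ (Λ s t x) e) (Λ s t)) V) λ w →
        ≗-closed V (λ x → cong (_- 𝟙[ Λ s t x ≟² w ])
            (bracket-cong (Λ s t x ≟² zipWith _-_ w e) (zipWith _+_ (Λ s t x) e ≟² w)
              (λ eq → trans (cong (λ v → zipWith _+_ v e) eq) (subtract-add w e))
              (λ eq → trans (sym (add-subtract (Λ s t x) e)) (cong (λ v → zipWith _-_ v e) eq))))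
          (lines∈ s t (zipWith _-_ w e) w)
      where
      add-subtract : ∀ v e → zipWith _-_ (zipWith _+_ v e) e ≡ v
      add-subtract (a ∷ b ∷ []) (c ∷ d ∷ []) = cong₂ (λ a b → a ∷ b ∷ []) ([y+x]-x≡y c a) ([y+x]-x≡y d b)
      subtract-add : ∀ v e → zipWith _+_ (zipWith _-_ v e) e ≡ v
      subtract-add (a ∷ b ∷ []) (c ∷ d ∷ []) = cong₂ (λ a b → a ∷ b ∷ []) ([y-x]+x≡y c a) ([y-x]+x≡y d b)

    -- Raise by one the exponent that has room below `p`, shift in that coordinate only, and take
    -- the linear coefficient of the shift.
    line-products : ∀ s t i j → suc i ℕ.< p ⊎ suc j ℕ.< p →
      (λ x → (x₁ x + s * x₃ x) ^ i * (x₂ x + t * x₃ x) ^ j) ∈ ⟨ V ⟩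
    line-products s t i j (inj₁ i+1<p) = derivative V (L₁ s) (λ x → L₂ t x ^ j) i i+1<p λ u →
      ≗-closed V (λ x → cong (λ b → (L₁ s x + u) ^ suc i * b ^ j - L₁ s x ^ suc i * L₂ t x ^ j)
                             (+-identityʳ (L₂ t x)))
        (shift-difference s t (u ∷ 0# ∷ []) λ v → Vec.head v ^ suc i * Vec.head (Vec.tail v) ^ j)
    line-products s t i j (inj₂ j+1<p) = ≗-closed V (λ x → *-comm (L₂ t x ^ j) (L₁ s x ^ i))
      (derivative V (L₂ t) (λ x → L₁ s x ^ i) j j+1<p λ u →
        ≗-closed V (λ x → cong (λ a → (L₂ t x + u) ^ suc j * a ^ i - L₂ t x ^ suc j * L₁ s x ^ i)
                               (+-identityʳ (L₁ s x)))
          (shift-difference s t (0# ∷ u ∷ []) λ v → Vec.head (Vec.tail v) ^ suc j * Vec.head v ^ i))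

    -- With `c = k + l`, polarising a line product in `s` draws `x₃ ^ k` from its first factor, and
    -- polarising in `t` draws `x₃ ^ l` from its second.
    monomial∈ : ∀ a b c → a ℕ.< p → b ℕ.< p → 3 ℕ.+ (a ℕ.+ b ℕ.+ c) ℕ.≤ p ℕ.+ p →
      (λ x → x₁ x ^ a * x₂ x ^ b * x₃ x ^ c) ∈ ⟨ V ⟩
    monomial∈ a b c a<p b<p deg≤ with split-exponent a b c a<p b<p deg≤
    ... | k , l , c≡k+l , a+k<p , b+l<p , small = ≗-closed V regroup
        (polarise V x₂ x₃ (λ x → x₁ x ^ a * x₃ x ^ k) b l b+l<p λ t →
          ≗-closed V (λ x → *-comm (x₁ x ^ a * x₃ x ^ k) ((x₂ x + t * x₃ x) ^ (b ℕ.+ l)))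
            (polarise V x₁ x₃ (λ x → (x₂ x + t * x₃ x) ^ (b ℕ.+ l)) a k a+k<p λ s →
              line-products s t (a ℕ.+ k) (b ℕ.+ l) small))
      where
      regroup : ∀ x → x₂ x ^ b * x₃ x ^ l * (x₁ x ^ a * x₃ x ^ k) ≡ x₁ x ^ a * x₂ x ^ b * x₃ x ^ c
      regroup x = begin
        x₂ x ^ b * x₃ x ^ l * (x₁ x ^ a * x₃ x ^ k)      ≡⟨ *-collect (x₂ x ^ b) (x₃ x ^ l) (x₁ x ^ a) (x₃ x ^ k) ⟩
        x₁ x ^ a * x₂ x ^ b * (x₃ x ^ k * x₃ x ^ l)      ≡⟨ cong (x₁ x ^ a * x₂ x ^ b *_) (^-homo-* (x₃ x) k l) ⟨
        x₁ x ^ a * x₂ x ^ b * x₃ x ^ (k ℕ.+ l)           ≡⟨ cong (λ n → x₁ x ^ a * x₂ x ^ b * x₃ x ^ n) c≡k+l ⟨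
        x₁ x ^ a * x₂ x ^ b * x₃ x ^ c                   ∎

  -- The kernel [x = y] as a polynomial of total degree below p

  ∏ₗ : {A : Set} → List A → (A → K) → K
  ∏ₗ xs g = List.foldr _*_ 1# (List.map g xs)

  ∏ₗ-cong : ∀ {A} (xs : List A) {g h} → g ≗ h → ∏ₗ xs g ≡ ∏ₗ xs h
  ∏ₗ-cong []       g≗h = refl
  ∏ₗ-cong (x ∷ xs) g≗h = cong₂ _*_ (g≗h x) (∏ₗ-cong xs g≗h)

  ∏ₗ≡0 : ∀ {A} {xs : List A} {a} {g} → a List∈.∈ xs → g a ≡ 0# → ∏ₗ xs g ≡ 0#
  ∏ₗ≡0 {xs = x ∷ xs} {g = g} (here refl)  ga≡0 = trans (cong (_* ∏ₗ xs g) ga≡0) (zeroˡ (∏ₗ xs g))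
  ∏ₗ≡0 {xs = x ∷ xs} {g = g} (there a∈xs) ga≡0 = trans (cong (g x *_) (∏ₗ≡0 a∈xs ga≡0)) (zeroʳ (g x))

  ∏ₗ≢0 : ∀ {A} (xs : List A) {g} → (∀ {a} → a List∈.∈ xs → g a ≢ 0#) → ∏ₗ xs g ≢ 0#
  ∏ₗ≢0 []       g≢0 = 1≢0
  ∏ₗ≢0 (x ∷ xs) g≢0 = integral (g≢0 (here refl)) (∏ₗ≢0 xs (g≢0 ∘ there))

  -- x - y - c, written without subtraction to stay within reach of the semiring solver.
  factor : K → K → K → K
  factor x y c = x + - 1# * y + - 1# * c

  a-1*a : ∀ a → a + - 1# * a ≡ 0#
  a-1*a a = trans (cong (a +_) (-1*x≈-x a)) (-‿inverseʳ a)

  factor-diagonal : ∀ x c → factor x x c ≡ - 1# * c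
  factor-diagonal x c = trans (cong (_+ - 1# * c) (a-1*a x)) (+-identityˡ (- 1# * c))

  factor-root : ∀ x y → factor x y (x - y) ≡ 0#
  factor-root x y = trans (cong (λ z → z + - 1# * (x - y)) (cong (x +_) (-1*x≈-x y))) (a-1*a (x - y))

  -- Expands one factor at a time; the prefix `x ^ i * y ^ j` accumulates the degree already spent.
  factors-closed : (V : Subspace (K × K)) → ∀ cs i j →
    (∀ k l → k ℕ.+ l ℕ.≤ i ℕ.+ j ℕ.+ List.length cs → (λ (x , y) → x ^ k * y ^ l) ∈ ⟨ V ⟩) →
    (λ (x , y) → x ^ i * y ^ j * ∏ₗ cs (factor x y)) ∈ ⟨ V ⟩
  factors-closed V []       i j monomials∈ =
    ≗-closed V (λ _ → sym (*-identityʳ _)) (monomials∈ i j (ℕ.m≤m+n (i ℕ.+ j) 0))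
  factors-closed V (c ∷ cs) i j monomials∈ =
    ≗-closed V (λ (x , y) → sym (factor-expansion (x ^ i) (y ^ j) x y (- 1#) c (∏ₗ cs (factor x y))))
      (+-closed V
        (+-closed V
          (factors-closed V cs (suc i) j λ k l → monomials∈ k l ∘ raise refl)
          (*-closed V (- 1#) (factors-closed V cs i (suc j) λ k l → monomials∈ k l ∘ raise (ℕ.+-suc i j))))
        (*-closed V (- 1# * c) (factors-closed V cs i j λ k l k+l≤ →
          monomials∈ k l (ℕ.≤-trans k+l≤ (ℕ.+-monoʳ-≤ (i ℕ.+ j) (ℕ.n≤1+n n))))))
    where
    n = List.length cs
    raise : ∀ {d m} → m ≡ suc (i ℕ.+ j) → d ℕ.≤ m ℕ.+ n → d ℕ.≤ i ℕ.+ j ℕ.+ suc n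
    raise {d} refl d≤ = subst (d ℕ.≤_) (sym (ℕ.+-suc (i ℕ.+ j) n)) d≤

  -- Take the product of `x - y - c` over the `p - 1` nonzero `c`. Off the diagonal the factor with
  -- `c = x - y` vanishes; on it the product is the nonzero constant given by the `- c`.
  diagonal∈ : (V : Subspace (K × K)) →
    (∀ i j → i ℕ.+ j ℕ.< p → (λ (x , y) → x ^ i * y ^ j) ∈ ⟨ V ⟩) →
    (λ (x , y) → 𝟙[ x Fin.≟ y ]) ∈ ⟨ V ⟩
  diagonal∈ V monomials∈ = *-cancel V (∏ₗ≢0 cs negative≢0)
    (≗-closed V (λ (x , y) → evaluate x y) (factors-closed V cs 0 0 λ i j i+j≤ →
      monomials∈ i j (ℕ.≤-<-trans i+j≤ length<p)))
    where
    nonzero? : Decidable (_≢ 0#)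
    nonzero? c = ¬? (c Fin.≟ 0#)
    cs = List.filter nonzero? (allFin p)
    length<p : List.length cs ℕ.< p
    length<p = subst (List.length cs ℕ.<_) (List.length-tabulate {n = p} (λ a → a))
      (List.filter-notAll nonzero? (allFin p) (Any.map (λ 0≡c c≢0 → c≢0 (sym 0≡c)) (∈-allFin 0#)))
    negative≢0 : ∀ {c} → c List∈.∈ cs → - 1# * c ≢ 0#
    negative≢0 {c} c∈cs -c≡0 = proj₂ (∈-filter⁻ nonzero? {xs = allFin p} c∈cs) (begin
      c                  ≡⟨ +-identityʳ c ⟨
      c + 0#             ≡⟨ cong (c +_) -c≡0 ⟨
      c + - 1# * c       ≡⟨ a-1*a c ⟩
      0#                 ∎)
    evaluate : ∀ x y → 1# * 1# * ∏ₗ cs (factor x y) ≡ ∏ₗ cs (- 1# *_) * 𝟙[ x Fin.≟ y ]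
    evaluate x y = trans (trans (cong (_* ∏ₗ cs (factor x y)) (*-identityˡ 1#)) (*-identityˡ _)) (value (x Fin.≟ y))
      where
      value : (x≟y : Dec (x ≡ y)) → ∏ₗ cs (factor x y) ≡ ∏ₗ cs (- 1# *_) * 𝟙[ x≟y ]
      value (yes refl) = trans (∏ₗ-cong cs (factor-diagonal x)) (sym (*-identityʳ _))
      value (no x≢y)   = trans
        (∏ₗ≡0 (∈-filter⁺ nonzero? (∈-allFin (x - y)) (x≢y ∘ x-y≡0⇒x≡y x y)) (factor-root x y))
        (sym (zeroʳ (∏ₗ cs (- 1# *_))))

  -- Separation of variables

  integral-linear : ∀ {X Y A} (as : List A) (W : Y → A → K) (F : Y → A → X) →
                    Linear (λ k y → ∑ₗ as (λ a → W y a * k (F y a)))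
  integral-linear as W F = record
    { φ-cong = λ g≗h y → ∑ₗ-cong as λ a → cong (W y a *_) (g≗h (F y a))
    ; φ-+    = λ g h y → trans (∑ₗ-cong as λ a → distribˡ (W y a) (g (F y a)) (h (F y a)))
        (∑ₗ-+ as (λ a → W y a * g (F y a)) (λ a → W y a * h (F y a)))
    ; φ-*    = λ c g y → trans (∑ₗ-cong as λ a → *-swap (W y a) c (g (F y a)))
        (∑ₗ-* as c (λ a → W y a * g (F y a)))
    }

  -- The sum is linear in the kernel that multiplies `W`, so the monomial expansion of the bracket
  -- may be carried out under it.
  diagonal-integral∈ : ∀ {Y A} (V : Subspace Y) (as : List A) (W : Y → A → K) (x : Y → K) (y : A → K) →
    (∀ i j → i ℕ.+ j ℕ.< p → (λ u → ∑ₗ as (λ a → W u a * (x u ^ i * y a ^ j))) ∈ ⟨ V ⟩) →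
    (λ u → ∑ₗ as (λ a → W u a * 𝟙[ x u Fin.≟ y a ])) ∈ ⟨ V ⟩
  diagonal-integral∈ V as W x y = diagonal∈ (preimage (integral-linear as W (λ u a → x u , y a)) V)

  module _ (V : Subspace (Point p)) (lines∈ : ContainsLineDifferences V) {f} (f-divisible : f ∈ PDivisible p) where

    points : List (Point p)
    points = vectors p 3

    -- The sum factors into a monomial in `x` and a moment of `f`: either the moment vanishes or the
    -- monomial has low enough degree for `monomial∈`.
    separated∈ : ∀ a₁ b₁ a₂ b₂ a₃ b₃ → a₁ ℕ.+ b₁ ℕ.< p → a₂ ℕ.+ b₂ ℕ.< p → a₃ ℕ.+ b₃ ℕ.< p →
      (λ x → ∑ₗ points λ y → f y * (x₃ x ^ a₃ * x₃ y ^ b₃) * (x₂ x ^ a₂ * x₂ y ^ b₂)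
                                 * (x₁ x ^ a₁ * x₁ y ^ b₁)) ∈ ⟨ V ⟩
    separated∈ a₁ b₁ a₂ b₂ a₃ b₃ d₁<p d₂<p d₃<p = ≗-closed V
      (λ x → sym (trans
        (∑ₗ-cong points λ y → separate (f y) (x₁ x ^ a₁) (x₂ x ^ a₂) (x₃ x ^ a₃) (x₁ y ^ b₁) (x₂ y ^ b₂) (x₃ y ^ b₃))
        (∑ₗ-* points (x₁ x ^ a₁ * x₂ x ^ a₂ * x₃ x ^ a₃) (λ y → f y * (x₁ y ^ b₁ * x₂ y ^ b₂ * x₃ y ^ b₃)))))
      product∈
      where
      b = b₁ ℕ.+ b₂ ℕ.+ b₃
      moment = ∑ₗ points λ y → f y * (x₁ y ^ b₁ * x₂ y ^ b₂ * x₃ y ^ b₃)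
      degree≤ : p ℕ.≤ b → 3 ℕ.+ (a₁ ℕ.+ a₂ ℕ.+ a₃) ℕ.≤ p ℕ.+ p
      degree≤ p≤b = ℕ.+-cancelʳ-≤ p _ _ (ℕ.≤-trans (ℕ.+-monoʳ-≤ (3 ℕ.+ (a₁ ℕ.+ a₂ ℕ.+ a₃)) p≤b)
        (subst (ℕ._≤ p ℕ.+ p ℕ.+ p) (exchange-sums a₁ a₂ a₃ b₁ b₂ b₃)
          (ℕ.+-mono-≤ (ℕ.+-mono-≤ d₁<p d₂<p) d₃<p)))
      product∈ : (λ x → x₁ x ^ a₁ * x₂ x ^ a₂ * x₃ x ^ a₃ * moment) ∈ ⟨ V ⟩
      product∈ with b ℕ.<? p
      ... | yes b<p = ≗-closed V (λ x → sym (trans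
              (cong (x₁ x ^ a₁ * x₂ x ^ a₂ * x₃ x ^ a₃ *_) (low-degree-annihilates f-divisible b₁ b₂ b₃ b<p))
              (zeroʳ (x₁ x ^ a₁ * x₂ x ^ a₂ * x₃ x ^ a₃)))) (0-closed V)
      ... | no  b≮p = ≗-closed V (λ x → *-comm moment _)
              (*-closed V moment (monomial∈ V lines∈ a₁ a₂ a₃
                (ℕ.m+n≤o⇒m≤o (suc a₁) d₁<p) (ℕ.m+n≤o⇒m≤o (suc a₂) d₂<p) (degree≤ (ℕ.≮⇒≥ b≮p))))

    -- The three brackets of the reproducing sum are replaced by monomials in turn, third coordinate
    -- first; between rounds the next bracket is moved to the last position.
    divisible⇒∈ : f ∈ ⟨ V ⟩
    divisible⇒∈ = ≗-closed V reproduce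
      (diagonal-integral∈ V points (λ x y → f y * δ₁ x y * δ₂ x y) x₃ x₃ λ a₃ b₃ d₃<p →
        ≗-closed V (λ x → ∑ₗ-cong points λ y → *-right-swap (f y * δ₁ x y) (x₃ x ^ a₃ * x₃ y ^ b₃) (δ₂ x y))
          (diagonal-integral∈ V points (λ x y → f y * δ₁ x y * (x₃ x ^ a₃ * x₃ y ^ b₃)) x₂ x₂ λ a₂ b₂ d₂<p →
            ≗-closed V (λ x → ∑ₗ-cong points λ y → rotate (f y) (x₃ x ^ a₃ * x₃ y ^ b₃) (x₂ x ^ a₂ * x₂ y ^ b₂) (δ₁ x y))
              (diagonal-integral∈ V points (λ x y → f y * (x₃ x ^ a₃ * x₃ y ^ b₃) * (x₂ x ^ a₂ * x₂ y ^ b₂)) x₁ x₁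
                λ a₁ b₁ d₁<p → separated∈ a₁ b₁ a₂ b₂ a₃ b₃ d₁<p d₂<p d₃<p)))
      where
      δ₁ δ₂ δ₃ : Point p → Point p → K
      δ₁ x y = 𝟙[ x₁ x Fin.≟ x₁ y ]
      δ₂ x y = 𝟙[ x₂ x Fin.≟ x₂ y ]
      δ₃ x y = 𝟙[ x₃ x Fin.≟ x₃ y ]

      rotate : ∀ a b c d → a * b * c * d ≡ a * d * b * c
      rotate a b c d = trans (*-right-swap (a * b) c d) (cong (_* c) (*-right-swap a b d))

      off-diagonal : ∀ a x y → y ≢ x → a * δ₁ x y * δ₂ x y * δ₃ x y ≡ 0#
      off-diagonal a (x ∷ x′ ∷ x″ ∷ []) (y ∷ y′ ∷ y″ ∷ []) y≢x =
        vanish (x Fin.≟ y) (x′ Fin.≟ y′) (x″ Fin.≟ y″)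
        where
        absorb : ∀ {b} c → b ≡ 0# → b * c ≡ 0#
        absorb c b≡0 = trans (cong (_* c) b≡0) (zeroˡ c)
        vanish : (d₁ : Dec (x ≡ y)) (d₂ : Dec (x′ ≡ y′)) (d₃ : Dec (x″ ≡ y″)) →
                 a * 𝟙[ d₁ ] * 𝟙[ d₂ ] * 𝟙[ d₃ ] ≡ 0#
        vanish (no _)     d₂         d₃         = absorb 𝟙[ d₃ ] (absorb 𝟙[ d₂ ] (zeroʳ a))
        vanish (yes _)    (no _)     d₃         = absorb 𝟙[ d₃ ] (zeroʳ (a * 1#))
        vanish (yes _)    (yes _)    (no _)     = zeroʳ (a * 1# * 1#)
        vanish (yes refl) (yes refl) (yes refl) = contradiction refl y≢x

      diagonal : ∀ a x → a * δ₁ x x * δ₂ x x * δ₃ x x ≡ a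
      diagonal a x = begin
        a * δ₁ x x * δ₂ x x * δ₃ x x    ≡⟨ cong₂ _*_ (cong₂ _*_ (cong (a *_) (one x₁)) (one x₂)) (one x₃) ⟩
        a * 1# * 1# * 1#                ≡⟨ *-identityʳ (a * 1# * 1#) ⟩
        a * 1# * 1#                     ≡⟨ *-identityʳ (a * 1#) ⟩
        a * 1#                          ≡⟨ *-identityʳ a ⟩
        a                               ∎
        where
        one : ∀ (x′ : Point p → K) → 𝟙[ x′ x Fin.≟ x′ x ] ≡ 1#
        one x′ = bracket-yes (x′ x Fin.≟ x′ x) refl

      reproduce : ∀ x → ∑ₗ points (λ y → f y * δ₁ x y * δ₂ x y * δ₃ x y) ≡ f x
      reproduce x = trans
        (∑ₗ-single (vectors-unique p 3) (vectors-complete p x) (λ y → off-diagonal (f y) x y))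
        (diagonal (f x) x)

  -- Spans of lines and cylinders

  span : Pred (Function p) 0ℓ → Subspace (Point p)
  span G = record
    { ⟨_⟩      = Span p G
    ; ≗-closed = λ where g≗h (n , c , b , b∈ , g≗) → n , c , b , b∈ , λ x → trans (sym (g≗h x)) (g≗ x)
    ; 0-closed = zero-sum
    ; +-closed = add
    ; *-closed = λ where
        d (n , c , b , b∈ , g≗) → n , (λ i → d * c i) , b , b∈ , λ x → begin
          d * _                                  ≡⟨ cong (d *_) (g≗ x) ⟩
          d * sum (λ i → c i * b i x)            ≡⟨ *-distribˡ-sum d (λ i → c i * b i x) ⟩
          sum (λ i → d * (c i * b i x))          ≡⟨ sum-cong-≗ (λ i → sym (*-assoc d (c i) (b i x))) ⟩
          sum (λ i → d * c i * b i x)            ∎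
    }
    where
    zero-sum : Span p G (λ _ → 0#)
    zero-sum = 0 , (λ ()) , (λ ()) , (λ ()) , λ _ → refl
    cons : ∀ d {b₀ h} → b₀ ∈ G → h ∈ Span p G → (λ x → d * b₀ x + h x) ∈ Span p G
    cons d {b₀} b₀∈ (n , c , b , b∈ , h≗) =
      suc n , d Vector.∷ c , b₀ Vector.∷ b , (λ { zero → b₀∈ ; (suc i) → b∈ i }) ,
      λ x → cong (d * b₀ x +_) (h≗ x)
    -- Concatenates two linear combinations by prepending the terms of one to the other.
    extend : ∀ {h} → h ∈ Span p G → ∀ n c (b : Vector (Function p) n) → (∀ i → b i ∈ G) →
             (λ x → sum (λ i → c i * b i x) + h x) ∈ Span p G
    extend (m , c′ , b′ , b′∈ , h≗) zero c b b∈ =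
      m , c′ , b′ , b′∈ , λ x → trans (+-identityˡ _) (h≗ x)
    extend h∈ (suc n) c b b∈
      with cons (c zero) (b∈ zero) (extend h∈ n (c ∘ suc) (b ∘ suc) (b∈ ∘ suc))
    ... | m , c′ , b′ , b′∈ , sum≗ = m , c′ , b′ , b′∈ , λ x → trans (+-assoc _ _ _) (sum≗ x)
    add : ∀ {g h} → g ∈ Span p G → h ∈ Span p G → (λ x → g x + h x) ∈ Span p G
    add {h = h} (n , c , b , b∈ , g≗) h∈ with extend h∈ n c b b∈
    ... | m , c′ , b′ , b′∈ , sum≗ = m , c′ , b′ , b′∈ , λ x → trans (cong (_+ h x) (g≗ x)) (sum≗ x)

  generator∈span : ∀ G {g} → g ∈ G → g ∈ Span p G
  generator∈span G {g} g∈ = 1 , (λ _ → 1#) , (λ _ → g) , (λ _ → g∈) ,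
    λ x → sym (trans (+-identityʳ (1# * g x)) (*-identityˡ (g x)))

  span-mono : ∀ (G H : Pred (Function p) 0ℓ) → (∀ {g} → g ∈ G → g ∈ H) → ∀ {g} → g ∈ Span p G → g ∈ Span p H
  span-mono G H G⊆H (n , c , b , b∈ , g≗) = n , c , b , G⊆H ∘ b∈ , g≗

  sum-zero : ∀ {n} {g : Vector K n} → (∀ i → g i ≡ 0#) → sum g ≡ 0#
  sum-zero {n} g≡0 = trans (sum-cong-≗ g≡0) (sum-replicate-zero n)

  sum-single : ∀ {n} {g : Vector K n} a → (∀ i → i ≢ a → g i ≡ 0#) → sum g ≡ g a
  sum-single {g = g} zero    g≡0 = trans (cong (g zero +_) (sum-zero λ i → g≡0 (suc i) λ ())) (+-identityʳ (g zero))
  sum-single {g = g} (suc a) g≡0 = trans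
    (cong₂ _+_ (g≡0 zero λ ()) (sum-single a λ i i≢a → g≡0 (suc i) (i≢a ∘ Fin.suc-injective)))
    (+-identityˡ (g (suc a)))

  -- Disjointness leaves at most one nonzero summand at each point, so the indicator of the union is
  -- the sum of the indicators.
  cylinder⇒type : ∀ {g} → g ∈ CylinderFunction p → g ∈ CylinderTypeWeight p
  cylinder⇒type (C , g≗) = lines , parallel , λ x → trans (g≗ x) (indicator x (points? x))
    where
    open Cylinder C
    indicator : ∀ x (x∈? : Dec (x ∈ Cylinder.points C)) → 𝟙[ x∈? ] ≡ sum (λ i → 𝟏 p (⟦_⟧? p (lines i)) x)
    indicator x (yes (a , x∈a)) = sym (trans
      (sum-single a λ i i≢a → bracket-no (⟦_⟧? p (lines i) x) λ x∈i → disjoint i a i≢a (x∈i , x∈a))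
      (bracket-yes (⟦_⟧? p (lines a) x) x∈a))
    indicator x (no x∉)         = sym (sum-zero λ i → bracket-no (⟦_⟧? p (lines i) x) λ x∈i → x∉ (i , x∈i))

  -- The fibre of `Λ s t` over `w`, with the third coordinate as parameter.
  line : K → K → K² → Line p
  line s t w = record
    { base        = Vec.head w ∷ Vec.head (Vec.tail w) ∷ 0# ∷ []
    ; direction   = - s ∷ - t ∷ 1# ∷ []
    ; direction≢0 = 1≢0 ∘ cong x₃
    }

  line⇒Λ : ∀ s t w x → x ∈ ⟦_⟧ p (line s t w) → Λ s t x ≡ w
  line⇒Λ s t (a ∷ b ∷ []) _ (τ , refl) = cong₂ (λ a b → a ∷ b ∷ [])
    (trans (line-form a s (- s) τ) (vanish₁ a s τ))
    (trans (line-form b t (- t) τ) (vanish₁ b t τ))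

  Λ⇒line : ∀ s t w x → Λ s t x ≡ w → x ∈ ⟦_⟧ p (line s t w)
  Λ⇒line s t _ (a ∷ b ∷ c ∷ []) refl = c ,
    cong₂ _∷_ (sym (trans (line-base a s (- s) c) (vanish₁ a s c)))
      (cong₂ _∷_ (sym (trans (line-base b t (- t) c) (vanish₁ b t c)))
        (cong (_∷ []) (sym (trans (+-identityˡ (c * 1#)) (*-identityʳ c)))))

  line-parallel : ∀ s t v w → _∥_ p (line s t v) (line s t w)
  line-parallel s t v w = 1# , cong₂ _∷_ (sym (*-identityˡ (- s)))
    (cong₂ _∷_ (sym (*-identityˡ (- t))) (cong (_∷ []) (sym (*-identityˡ 1#))))

  line-indicator : ∀ s t w x → 𝟏 p (⟦_⟧? p (line s t w)) x ≡ 𝟙[ Λ s t x ≟² w ]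
  line-indicator s t w x =
    bracket-cong (⟦_⟧? p (line s t w) x) (Λ s t x ≟² w) (line⇒Λ s t w x) (Λ⇒line s t w x)

  parallel-differences-contain : ContainsLineDifferences (span (ParallelDifference p))
  parallel-differences-contain s t v w = generator∈span (ParallelDifference p)
    (line s t v , line s t w , line-parallel s t v w ,
     λ x → sym (cong₂ _-_ (line-indicator s t v x) (line-indicator s t w x)))

  -- Exchanging one line of a cylinder

  module _ (s t : K) where

    cylinder : (φ : K → K²) → (∀ {i j} → φ i ≡ φ j → i ≡ j) → Cylinder p
    cylinder φ φ-injective = record
      { lines    = line s t ∘ φ
      ; parallel = λ i j → line-parallel s t (φ i) (φ j)
      ; disjoint = λ i j i≢j {x} (x∈i , x∈j) → i≢j (φ-injective
          (trans (sym (line⇒Λ s t (φ i) x x∈i)) (line⇒Λ s t (φ j) x x∈j)))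
      }

    module _ (ψ : K → K²) (ψ-injective : ∀ {i j} → ψ i ≡ ψ j → i ≡ j) (a : K) where

      -- The index `a` is exempt: `v` may equal `ψ a`, so the original family counts as one of its
      -- own replacements.
      Avoids : K² → Set
      Avoids v = ∀ i → i ≢ a → ψ i ≢ v

      replace : K² → K → K²
      replace v i = if does (i Fin.≟ a) then v else ψ i

      replace-at : ∀ v → replace v a ≡ v
      replace-at v with a Fin.≟ a
      ... | yes _  = refl
      ... | no a≢a = contradiction refl a≢a

      replace-off : ∀ v {i} → i ≢ a → replace v i ≡ ψ i
      replace-off v {i} i≢a with i Fin.≟ a
      ... | yes i≡a = contradiction i≡a i≢a
      ... | no _    = refl

      replace-injective : ∀ {v} → Avoids v → ∀ {i j} → replace v i ≡ replace v j → i ≡ j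
      replace-injective avoids {i} {j} eq with i Fin.≟ a | j Fin.≟ a
      ... | yes i≡a | yes j≡a = trans i≡a (sym j≡a)
      ... | yes _   | no j≢a  = contradiction (sym eq) (avoids j j≢a)
      ... | no i≢a  | yes _   = contradiction eq (avoids i i≢a)
      ... | no _    | no _    = ψ-injective eq

      remaining? : ∀ x → Dec (∃ λ i → i ≢ a × Λ s t x ≡ ψ i)
      remaining? x = Fin.any? λ i → ¬? (i Fin.≟ a) ×-dec (Λ s t x ≟² ψ i)

      replaced : ∀ v → Avoids v → Cylinder p
      replaced v avoids = cylinder (replace v) (replace-injective avoids)

      -- The second summand is independent of `v` and cancels when two replacements are subtracted.
      replaced-indicator : ∀ v (avoids : Avoids v) x →
        𝟏 p (Cylinder.points? (replaced v avoids)) x ≡ 𝟙[ Λ s t x ≟² v ] + 𝟙[ remaining? x ]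
      replaced-indicator v avoids x = bracket-⊎ (Cylinder.points? (replaced v avoids) x) (Λ s t x ≟² v) (remaining? x)
        (λ (i , x∈) → locate i (line⇒Λ s t (replace v i) x x∈))
        (λ Λx≡v → a , Λ⇒line s t (replace v a) x (trans Λx≡v (sym (replace-at v))))
        (λ (i , i≢a , Λx≡ψi) → i , Λ⇒line s t (replace v i) x (trans Λx≡ψi (sym (replace-off v i≢a))))
        (λ Λx≡v (i , i≢a , Λx≡ψi) → avoids i i≢a (trans (sym Λx≡ψi) Λx≡v))
        where
        locate : ∀ i → Λ s t x ≡ replace v i → Λ s t x ≡ v ⊎ ∃ λ i → i ≢ a × Λ s t x ≡ ψ i
        locate i eq with i Fin.≟ a
        ... | yes _  = inj₁ eq
        ... | no i≢a = inj₂ (i , i≢a , eq)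

      exchange∈ : ∀ v w → Avoids v → Avoids w →
        (λ x → 𝟙[ Λ s t x ≟² v ] - 𝟙[ Λ s t x ≟² w ]) ∈ Span p (CylinderFunction p)
      exchange∈ v w v-avoided w-avoided = ≗-closed V
        (λ x → trans (cong₂ _-_ (replaced-indicator v v-avoided x) (replaced-indicator w w-avoided x))
                     (cancel 𝟙[ Λ s t x ≟² v ] 𝟙[ Λ s t x ≟² w ] 𝟙[ remaining? x ]))
        (minus-closed V (cylinder∈ (replaced v v-avoided))
                        (cylinder∈ (replaced w w-avoided)))
        where
        V = span (CylinderFunction p)
        cylinder∈ : ∀ C → 𝟏 p (Cylinder.points? C) ∈ ⟨ V ⟩
        cylinder∈ C = generator∈span (CylinderFunction p) (C , λ _ → refl)
        cancel : ∀ b c r → (b + r) - (c + r) ≡ b - c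
        cancel b c r = begin
          (b + r) - (c + r)        ≡⟨ cong (b + r +_) (-‿+-comm c r) ⟨
          (b + r) + (- c + - r)    ≡⟨ medial b r (- c) (- r) ⟩
          (b - c) + (r - r)        ≡⟨ cong (b - c +_) (-‿inverseʳ r) ⟩
          (b - c) + 0#             ≡⟨ +-identityʳ (b - c) ⟩
          b - c                    ∎

  -- Passes from `v` to `w` through the corner `u`. The row of points `(i, b)` exchanges `v` for
  -- `u`, the column of points `(a, i)` exchanges `u` for `w`; avoidance is read off one coordinate,
  -- whether or not `v` and `w` share one.
  cylinders-contain : ContainsLineDifferences (span (CylinderFunction p))
  cylinders-contain s t v@(a ∷ b ∷ []) w@(a′ ∷ b′ ∷ []) = ≗-closed V
    (λ x → telescope 𝟙[ Λ s t x ≟² v ] 𝟙[ Λ s t x ≟² u ] 𝟙[ Λ s t x ≟² w ])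
    (+-closed V
      (exchange∈ s t (λ i → i ∷ b ∷ []) (cong Vec.head) a v u (λ i i≢a → i≢a ∘ cong Vec.head) (λ i i≢a → i≢a ∘ cong Vec.head))
      (exchange∈ s t (λ i → a ∷ i ∷ []) (cong second) b′ u w (λ i i≢b′ → i≢b′ ∘ cong second) (λ i i≢b′ → i≢b′ ∘ cong second)))
    where
    V = span (CylinderFunction p)
    u = a ∷ b′ ∷ []
    second : K² → K
    second = Vec.head ∘ Vec.tail
    telescope : ∀ b c d → (b - c) + (c - d) ≡ b - d
    telescope b c d = trans (sym (+-assoc (b - c) c (- d))) (cong (_- d) ([y-x]+x≡y c b))

theorem1p11 : ∀ (p : ℕ) .{{_ : NonZero p}} → Prime p →
    (f : Function p) → f ∈ PDivisible p →
    f ∈ Span p (CylinderFunction p) ×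
    f ∈ Span p (CylinderTypeWeight p) ×
    f ∈ Span p (ParallelDifference p)
theorem1p11 p p-prime f f-divisible =
  f∈cylinders ,
  span-mono p p-prime (CylinderFunction p) (CylinderTypeWeight p) (cylinder⇒type p p-prime) f∈cylinders ,
  divisible⇒∈ p p-prime (span p p-prime (ParallelDifference p)) (parallel-differences-contain p p-prime) f-divisible
  where
  f∈cylinders : f ∈ Span p (CylinderFunction p)
  f∈cylinders = divisible⇒∈ p p-prime (span p p-prime (CylinderFunction p)) (cylinders-contain p p-prime) f-divisible
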